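{- For every integer $n\ge 2$, the number $t(n)$ of toppleable permutations in $S_n$ satisfies \[ t(n)=t_{\lfloor n/2\rfloor+1}(n)=t_{\lfloor n/2\rfloor+2}(n), \] and moreover $t(n)=a_{n,\lfloor (n-1)/2\rfloor}$, where $a_{n,k}$ denotes the number of permutations $\sigma\in S_n$ whose excedance set is exactly $\{1,\dots,k\}$.
   Context: Toppling model. For an integer $n\ge 2$ let $L_n=\{ -\lfloor (n+1)/2\rfloor,\dots,-1,0,1,\dots,\lfloor n/2\rfloor+1\}\subset\mathbb{Z}$; position $0$ is the origin. A configuration places chips carrying distinct integer labels at positions of $L_n$ (a position may hold several chips). A toppling move chooses a position $i$ holding at least two chips, chooses two chips $\alpha<\beta$ at $i$, and moves $\alpha$ to $i-1$ and $\beta$ to $i+1$. The toppling process applies toppling moves (with arbitrary choices) until no position holds two or more chips. For $\pi=(\pi_1,\dots,\pi_n)\in S_n$ and $r\in[n+1]=\{1,\dots,n+1\}$, the initial configuration $\pi^{(r)}$ has, for each $j=1,\dots,n$, one chip at position $-\lfloor (n-1)/2\rfloor+j-1$ labeled $\pi_j$ if $\pi_j<r$ and $\pi_j+1$ if $\pi_j\ge r$, and in addition a chip labeled $r$ at the origin; thus there are $n+1$ chips labeled $1,\dots,n+1$. Starting from $\pi^{(r)}$ the process stops with a final configuration that does not depend on the choices and has at most one chip per position; reading its chips from left to right gives a permutation $\mathcal{T}(\pi,r)\in S_{n+1}$. A permutation $\pi\in S_n$ is $r$-toppleable if $\mathcal{T}(\pi,r)$ is the identity, and toppleable if it is $r$-toppleable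 for every $r\in[n+1]$. Let $t_r(n)$ be the number of $r$-toppleable permutations in $S_n$ and $t(n)$ the number of toppleable ones. An excedance of $\sigma\in S_n$ is an index $i$ with $\sigma_i>i$; the excedance set is the set of all excedances. -}

module Defs where

open import Data.Nat as ℕ using (ℕ; zero; suc; _≤_; _<_; _<ᵇ_; _∸_)
open import Data.Nat.DivMod using (_/_)
open import Data.Integer as ℤ using (ℤ; +_; -_)
open import Data.Bool using (if_then_else_)
open import Data.Product using (Σ; ∃; _×_; _,_; proj₂)
open import Data.List using (List; []; _∷_; length; map; upTo; lookup)
open import Data.List.Relation.Unary.Unique.Propositional using (Unique)
open import Data.List.Relation.Unary.AllPairs using (AllPairs)
open import Data.List.Membership.Propositional using (_∈_)
open import Data.List.Relation.Binary.Permutation.Propositional using (_↭_)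
open import Data.Fin using (Fin; toℕ)
open import Relation.Binary.PropositionalEquality using (_≡_; _≢_)
open import Relation.Binary.Construct.Closure.ReflexiveTransitive using (Star)
open import Function.Bundles using (_⇔_)

IsPerm : ℕ → List ℕ → Set
IsPerm n w = w ↭ map suc (upTo n)

Count : (List ℕ → Set) → ℕ → Set
Count P k = Σ (List (List ℕ)) λ xs →
  Unique xs × length xs ≡ k × (∀ w → (w ∈ xs) ⇔ P w)

-- Toppling model.  A configuration is a list of chips (label , position).

Config : Set
Config = List (ℕ × ℤ)

InL : ℕ → ℤ → Set
InL n p = (- (+ (suc n / 2))) ℤ.≤ p × p ℤ.≤ + (suc (n / 2))

AllInL : ℕ → Config → Set
AllInL n c = ∀ {α p} → (α , p) ∈ c → InL n p

setAt : Config → ℕ → ℕ × ℤ → Config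
setAt [] _ _ = []
setAt (x ∷ c) zero y = y ∷ c
setAt (x ∷ c) (suc j) y = x ∷ setAt c j y

data Move (n : ℕ) (c : Config) : Config → Set where
  topple : (j k : Fin (length c)) (α β : ℕ) (i : ℤ) →
           lookup c j ≡ (α , i) → lookup c k ≡ (β , i) → α < β →
           let c′ = setAt (setAt c (toℕ j) (α , i ℤ.- + 1)) (toℕ k) (β , i ℤ.+ + 1) in
           AllInL n c′ → Move n c c′

Stable : Config → Set
Stable c = AllPairs _≢_ (map proj₂ c)

ReadsIdentity : Config → Set
ReadsIdentity c = ∀ {α p β q} → (α , p) ∈ c → (β , q) ∈ c → α < β → p ℤ.< q

relabel : ℕ → ℕ → ℕ
relabel r x = if x <ᵇ r then x else suc x

chipsFrom : ℕ → ℕ → ℕ → List ℕ → Config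
chipsFrom n r j [] = []
chipsFrom n r j (x ∷ xs) =
  (relabel r x , (- (+ ((n ∸ 1) / 2))) ℤ.+ + j) ∷ chipsFrom n r (suc j) xs

initial : ℕ → List ℕ → Config
initial r π = (r , + 0) ∷ chipsFrom (length π) r 0 π

RToppleable : ℕ → List ℕ → Set
RToppleable r π = ∃ λ c →
  Star (Move (length π)) (initial r π) c × Stable c × ReadsIdentity c

Toppleable : List ℕ → Set
Toppleable π = ∀ r → 1 ≤ r → r ≤ suc (length π) → RToppleable r π

entry : List ℕ → ℕ → ℕ      -- 0-based entry, 0 when out of range
entry [] _ = 0
entry (x ∷ xs) zero = x
entry (x ∷ xs) (suc i) = entry xs i

IsExcedance : List ℕ → ℕ → Set
IsExcedance σ i = (1 ≤ i × i ≤ length σ) × i < entry σ (i ∸ 1)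

ExcSetIsInitial : ℕ → List ℕ → Set
ExcSetIsInitial k σ = ∀ i → IsExcedance σ i ⇔ (1 ≤ i × i ≤ k)

{-# OPTIONS --safe #-}
-- Number the positions of L_n by x = 0, …, n + 1 and let g x be max(p , 0) + 1 plus the
-- number of topplings so far at the position p of x.  Equivalently, g 0 = 1 and
-- g (x + 1) − g x is the number of chips to the left of x + 1, minus x; it is 0 or 1.
-- A chip v at x is admissible if g x ≤ v and v + g x ≤ s + 1 + x, with s = ⌊n/2⌋ + 1.
-- A toppling at x only raises g x by 1, and it requires g (x − 1) = g x = g (x + 1) − 1; hence
-- all chips are admissible before a move if and only if they are after it, whatever the move.
-- In a stable configuration g x = 1 + min(x , s), and there admissibility says that the chips
-- are sorted, as one sees by counting labels against positions.  In the initial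
-- configuration it is a band condition on π, which is the same, and the most restrictive, for
-- r = ⌊n/2⌋ + 1 and r = ⌊n/2⌋ + 2.  Reverse-complementing and rotating π turns the band
-- condition into the condition on the excedance set.
module Submission where

open import Defs
open import Data.Nat using (ℕ; zero; suc; _+_; _*_; _∸_; _⊓_; _≤_; _<_; _<ᵇ_; z≤n; s≤s; s≤s⁻¹)
open import Data.Nat.Properties
open import Data.Nat.DivMod using (_/_; m/n≡1+[m∸n]/n; m/n≤m; m/n<m)
open import Data.Nat.ListAction using (sum)
open import Data.Nat.ListAction.Properties using (sum-↭)
open import Data.Nat.Tactic.RingSolver using (solve-∀)
open import Data.Integer as ℤ using (ℤ; +_; -_; ∣_∣)
import Data.Integer.Properties as ℤ
import Data.Integer.Tactic.RingSolver as ℤ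
open import Data.Bool using (true; false)
open import Data.Fin using (Fin; zero; suc; toℕ)
open import Data.Fin.Properties using () renaming (suc-injective to suc-injectiveᶠ)
open import Data.Product using (∃; _×_; _,_; proj₁; proj₂)
open import Data.Sum as Sum using (_⊎_; inj₁; inj₂)
open import Data.List using (List; []; _∷_; _++_; _∷ʳ_; map; length; lookup; upTo; downFrom;
  reverse; take; drop; filter; cartesianProductWith)
open import Data.List.Properties using (map-∘; map-++; map-cong; map-cong-local; map-id-local;
  map-upTo; length-map; length-upTo; length-++; length-take; length-drop; length-reverse;
  take++drop≡id; unfold-reverse; reverse-involutive; reverse-map; reverse-upTo; ∷-injective)
open import Data.List.Relation.Unary.All as All using (All; []; _∷_)
import Data.List.Relation.Unary.All.Properties as All
open import Data.List.Relation.Unary.Any as Any using (here; there)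
import Data.List.Relation.Unary.Any.Properties as Any
open import Data.List.Relation.Unary.AllPairs using ([]; _∷_)
open import Data.List.Relation.Unary.Unique.Propositional using (Unique)
import Data.List.Relation.Unary.Unique.Propositional.Properties as Unique
open import Data.List.Membership.Propositional using (_∈_)
open import Data.List.Membership.Propositional.Properties using (∈-map⁺; ∈-map⁻; ∈-upTo⁻;
  ∈-lookup; ∈-∃++; ∈-filter⁺; ∈-filter⁻; ∈-cartesianProductWith⁺)
open import Data.List.Membership.DecPropositional _≟_ using (_∈?_)
open import Data.List.Relation.Binary.Permutation.Propositional
  using (_↭_; ↭-refl; ↭-sym; ↭-trans; ↭-reflexive; ↭⇒↭ₛ; prep; swap; module PermutationReasoning)
import Data.List.Relation.Binary.Permutation.Propositional.Properties as ↭
import Data.List.Relation.Binary.Permutation.Setoid.Properties as ↭ₛ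
open import Relation.Nullary using (¬_; Dec; yes; no; contradiction)
open import Relation.Nullary.Decidable using (map′; _×-dec_)
open import Relation.Binary.Definitions using (tri<; tri≈; tri>)
open import Relation.Binary.Construct.Closure.ReflexiveTransitive using (Star; ε; _◅_)
open import Relation.Binary.PropositionalEquality
open import Function.Base using (_∘_; id)
open import Function.Bundles using (_⇔_; mk⇔; module Equivalence)
open import Function.Construct.Composition using (_⇔-∘_)

-- Counting

-- The indicators are numbers, so that counts are sums of them, and adding one to both arguments
-- changes nothing up to reduction.
⟦_<_⟧ : ℕ → ℕ → ℕ
⟦ _     < zero  ⟧ = 0
⟦ zero  < suc _ ⟧ = 1
⟦ suc p < suc x ⟧ = ⟦ p < x ⟧

⟦_≡_⟧ : ℕ → ℕ → ℕ
⟦ zero  ≡ zero  ⟧ = 1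
⟦ zero  ≡ suc _ ⟧ = 0
⟦ suc _ ≡ zero  ⟧ = 0
⟦ suc p ≡ suc x ⟧ = ⟦ p ≡ x ⟧

⟦<⟧-true : ∀ {p x} → p < x → ⟦ p < x ⟧ ≡ 1
⟦<⟧-true {zero}  (s≤s _)   = refl
⟦<⟧-true {suc p} (s≤s p<x) = ⟦<⟧-true p<x

⟦<⟧-false : ∀ {p x} → x ≤ p → ⟦ p < x ⟧ ≡ 0
⟦<⟧-false z≤n       = refl
⟦<⟧-false (s≤s x≤p) = ⟦<⟧-false x≤p

⟦<⟧≤1 : ∀ p x → ⟦ p < x ⟧ ≤ 1
⟦<⟧≤1 p       zero    = z≤n
⟦<⟧≤1 zero    (suc x) = ≤-refl
⟦<⟧≤1 (suc p) (suc x) = ⟦<⟧≤1 p x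

⟦<⟧-mono : ∀ p x → ⟦ p < x ⟧ ≤ ⟦ p < suc x ⟧
⟦<⟧-mono p       zero    = z≤n
⟦<⟧-mono zero    (suc x) = ≤-refl
⟦<⟧-mono (suc p) (suc x) = ⟦<⟧-mono p x

⟦<⟧-suc : ∀ {p x} → p ≢ x → ⟦ p < suc x ⟧ ≡ ⟦ p < x ⟧
⟦<⟧-suc {zero}  {zero}  p≢x = contradiction refl p≢x
⟦<⟧-suc {suc p} {zero}  p≢x = refl
⟦<⟧-suc {zero}  {suc x} p≢x = refl
⟦<⟧-suc {suc p} {suc x} p≢x = ⟦<⟧-suc (p≢x ∘ cong suc)

⟦≡⟧-refl : ∀ x → ⟦ x ≡ x ⟧ ≡ 1
⟦≡⟧-refl zero    = refl
⟦≡⟧-refl (suc x) = ⟦≡⟧-refl x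

⟦≡⟧-false : ∀ {z x} → z ≢ x → ⟦ z ≡ x ⟧ ≡ 0
⟦≡⟧-false {zero}  {zero}  z≢x = contradiction refl z≢x
⟦≡⟧-false {zero}  {suc x} z≢x = refl
⟦≡⟧-false {suc z} {zero}  z≢x = refl
⟦≡⟧-false {suc z} {suc x} z≢x = ⟦≡⟧-false (z≢x ∘ cong suc)

-- The second difference of p ↦ ⟦ p < x ⟧: toppling 1 + y changes the number of
-- chips to the left of x only for x = 1 + y and x = 2 + y.
⟦<⟧-topple : ∀ y x → ⟦ y < x ⟧ + (⟦ 2 + y < x ⟧ + ⟦ 2 + y ≡ x ⟧)
                   ≡ ⟦ 1 + y < x ⟧ + (⟦ 1 + y < x ⟧ + ⟦ 1 + y ≡ x ⟧)
⟦<⟧-topple zero    zero                = refl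
⟦<⟧-topple zero    (suc zero)          = refl
⟦<⟧-topple zero    (suc (suc zero))    = refl
⟦<⟧-topple zero    (suc (suc (suc x))) = refl
⟦<⟧-topple (suc y) zero                = refl
⟦<⟧-topple (suc y) (suc x)             = ⟦<⟧-topple y x

#below : ℕ → List ℕ → ℕ
#below x ℓ = sum (map (λ p → ⟦ p < x ⟧) ℓ)

#below-↭ : ∀ x {ℓ ℓ′} → ℓ ↭ ℓ′ → #below x ℓ ≡ #below x ℓ′
#below-↭ x p = sum-↭ (↭.map⁺ _ p)

#below-zero : ∀ ℓ → #below 0 ℓ ≡ 0
#below-zero []      = refl
#below-zero (_ ∷ ℓ) = #below-zero ℓ

#below-map-suc : ∀ x ℓ → #below (suc x) (map suc ℓ) ≡ #below x ℓ
#below-map-suc x ℓ = cong sum (sym (map-∘ ℓ))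

#below≤length : ∀ x ℓ → #below x ℓ ≤ length ℓ
#below≤length x []      = z≤n
#below≤length x (p ∷ ℓ) = +-mono-≤ (⟦<⟧≤1 p x) (#below≤length x ℓ)

#below-mono : ∀ x ℓ → #below x ℓ ≤ #below (suc x) ℓ
#below-mono x []      = z≤n
#below-mono x (p ∷ ℓ) = +-mono-≤ (⟦<⟧-mono p x) (#below-mono x ℓ)

#below-suc : ∀ {x ℓ} → All (_≢ x) ℓ → #below (suc x) ℓ ≡ #below x ℓ
#below-suc []        = refl
#below-suc (p ∷ ps) = cong₂ _+_ (⟦<⟧-suc p) (#below-suc ps)

-- Only an entry equal to `x` is counted anew, and a duplicate-free list has at most one.
#below-unique : ∀ x {ℓ} → Unique ℓ → #below (suc x) ℓ ≤ suc (#below x ℓ)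
#below-unique x []                   = z≤n
#below-unique x {p ∷ ℓ} (p∉ℓ ∷ ℓ!) with p ≟ x
... | yes refl = +-mono-≤ (⟦<⟧≤1 p (suc p))
                   (≤-trans (≤-reflexive (#below-suc (All.map (_∘ sym) p∉ℓ)))
                            (m≤n+m _ ⟦ p < p ⟧))
... | no  p≢x  = ≤-trans (+-mono-≤ (≤-reflexive (⟦<⟧-suc p≢x)) (#below-unique x ℓ!))
                   (≤-reflexive (+-suc ⟦ p < x ⟧ _))

#below-upTo : ∀ {x n} → x ≤ n → #below x (upTo n) ≡ x
#below-upTo {n = n} z≤n = #below-zero (upTo n)
#below-upTo {suc x} {suc n} (s≤s x≤n) =
  cong suc (trans (cong (#below (suc x)) (sym (map-upTo suc n)))
           (trans (#below-map-suc x (upTo n)) (#below-upTo x≤n)))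

#below-upTo⁺ : ∀ {x n} → x ≤ n → #below (suc x) (map suc (upTo n)) ≡ x
#below-upTo⁺ {x} {n} x≤n = trans (#below-map-suc x (upTo n)) (#below-upTo x≤n)

+-tight : ∀ {a b c d} → a ≤ b → c ≤ d → a + c ≡ b + d → a ≡ b × c ≡ d
+-tight {a} {b} {c} {d} a≤b c≤d eq = a≡b , +-cancelˡ-≡ a c d (trans eq (cong (_+ d) (sym a≡b)))
  where
  a≡b : a ≡ b
  a≡b = ≤-antisym a≤b (+-cancelʳ-≤ c b a
          (≤-trans (+-monoʳ-≤ b c≤d) (≤-reflexive (sym eq))))

sum-mono : ∀ {A : Set} {f g : A → ℕ} {xs} → All (λ a → f a ≤ g a) xs →
           sum (map f xs) ≤ sum (map g xs)
sum-mono []       = z≤n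
sum-mono (p ∷ ps) = +-mono-≤ p (sum-mono ps)

-- Equal totals leave no slack in any term. This is how equalities between counts become statements
-- on single chips.
sum-tight : ∀ {A : Set} {f g : A → ℕ} {xs} → All (λ a → f a ≤ g a) xs →
            sum (map f xs) ≡ sum (map g xs) → All (λ a → f a ≡ g a) xs
sum-tight []       eq = []
sum-tight (p ∷ ps) eq with e , es ← +-tight p (sum-mono ps) eq = e ∷ sum-tight ps es

-- Topplings and their profile

-- Chips as (label , x), where x = position + ⌊(n+1)/2⌋ ∈ {0,…,n+1}.

Chips : Set
Chips = List (ℕ × ℕ)

labels positions : Chips → List ℕ
labels    = map proj₁
positions = map proj₂

#below-map : ∀ x (f : ℕ × ℕ → ℕ) c → #below x (map f c) ≡ sum (map (λ a → ⟦ f a < x ⟧) c)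
#below-map x f c = cong sum (sym (map-∘ c))

-- A move up to reordering of the chips. `y` is the index of the left target, which avoids
-- subtraction, and `y < n` keeps the right target `2 + y` within `n + 1`.
record Topple (n : ℕ) (c c′ : Chips) : Set where
  field
    {α β y} : ℕ
    {rest}  : Chips
    α<β     : α < β
    y<n     : y < n
    before  : c ↭ (α , suc y) ∷ (β , suc y) ∷ rest
    after   : c′ ↭ (α , y) ∷ (β , 2 + y) ∷ rest

-- `balance` is the difference equation of `g` without subtraction; with `bottom` it determines `g`
-- on `0, …, n + 1`. Summed over `x`, it shows that `top` fixes the sum of the positions, which
-- topplings conserve.
record Profile (n s : ℕ) (c : Chips) (g : ℕ → ℕ) : Set where
  field
    labelled : labels c ↭ map suc (upTo (suc n))
    inside   : All (λ a → proj₂ a ≤ suc n) c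
    bottom   : g 0 ≡ 1
    top      : g (suc n) ≡ suc s
    balance  : ∀ {x} → x ≤ n → #below (suc x) (positions c) + g x ≡ x + g (suc x)
    mono     : ∀ {x} → x ≤ n → g x ≤ g (suc x)
    lip      : ∀ {x} → x ≤ n → g (suc x) ≤ suc (g x)

-- The second inequality is the first one for the mirror image, in which `x` becomes `n + 1 − x`,
-- `v` becomes `n + 2 − v` and `g x` becomes `g x + n + 1 − x − s`.
Admissible : ℕ → (ℕ → ℕ) → Chips → Set
Admissible s g = All λ (v , x) → g x ≤ v × v + g x ≤ suc s + x

module _ {n s c c′ g} (P : Profile n s c g) (T : Topple n c c′) where
  open Profile P
  open Topple T

  private
    R : List ℕ
    R = positions rest

    y≤n : y ≤ n
    y≤n = <⇒≤ y<n

    #below-c : ∀ x → #below x (positions c) ≡ ⟦ 1 + y < x ⟧ + (⟦ 1 + y < x ⟧ + #below x R)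
    #below-c x = #below-↭ x (↭.map⁺ proj₂ before)

    #below-c′ : ∀ x → #below x (positions c′) ≡ ⟦ y < x ⟧ + (⟦ 2 + y < x ⟧ + #below x R)
    #below-c′ x = #below-↭ x (↭.map⁺ proj₂ after)

    l₁ l₂ : ℕ
    l₁ = #below (1 + y) R
    l₂ = #below (2 + y) R

    balance₁ : l₁ + g y ≡ y + g (1 + y)
    balance₁ = trans (cong (_+ g y) (sym eq)) (balance y≤n)
      where
      eq : #below (1 + y) (positions c) ≡ l₁
      eq rewrite #below-c (1 + y) | ⟦<⟧-false {y} {y} ≤-refl = refl

    balance₂ : (2 + l₂) + g (1 + y) ≡ (1 + y) + g (2 + y)
    balance₂ = trans (cong (_+ g (1 + y)) (sym eq)) (balance y<n)
      where
      eq : #below (2 + y) (positions c) ≡ 2 + l₂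
      eq rewrite #below-c (2 + y) | ⟦<⟧-true {y} {1 + y} ≤-refl = refl

    -- The two toppling chips exhaust the freedom of the profile: `mono` at `y` gives `y ≤ l₁`,
    -- `lip` at `1 + y` gives `l₂ ≤ y`, and `l₁ ≤ l₂` closes the chain. Hence `g` is flat just
    -- before `1 + y` and steep just after.
    y≤l₁ : y ≤ l₁
    y≤l₁ = +-cancelʳ-≤ (g y) y l₁
             (≤-trans (+-monoʳ-≤ y (mono y≤n)) (≤-reflexive (sym balance₁)))

    l₂≤y : l₂ ≤ y
    l₂≤y = s≤s⁻¹ (s≤s⁻¹ (+-cancelʳ-≤ (g (1 + y)) (2 + l₂) (2 + y)
             (≤-trans (≤-reflexive balance₂)
             (≤-trans (+-monoʳ-≤ (1 + y) (lip y<n))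
                      (≤-reflexive (+-suc (1 + y) (g (1 + y))))))))

    l₁≤l₂ : l₁ ≤ l₂
    l₁≤l₂ = #below-mono (1 + y) R

    l₁≡y : l₁ ≡ y
    l₁≡y = ≤-antisym (≤-trans l₁≤l₂ l₂≤y) y≤l₁

    l₂≡y : l₂ ≡ y
    l₂≡y = ≤-antisym l₂≤y (≤-trans y≤l₁ l₁≤l₂)

    flat : g (1 + y) ≡ g y
    flat = sym (+-cancelˡ-≡ y (g y) (g (1 + y)) (trans (cong (_+ g y) (sym l₁≡y)) balance₁))

    steep : g (2 + y) ≡ suc (g (1 + y))
    steep = sym (+-cancelˡ-≡ (1 + y) (suc (g (1 + y))) (g (2 + y))
              (trans (+-suc (1 + y) (g (1 + y)))
              (trans (cong (λ l → 2 + l + g (1 + y)) (sym l₂≡y)) balance₂)))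

    -- As `l₁` and `l₂` agree, no third chip lies at `1 + y`. Hence no chip of `rest` sees the
    -- change of `g`.
    elsewhere : All (λ a → proj₂ a ≢ suc y) rest
    elsewhere = All.map⁻ (All.map distinct (sum-tight (All.universal (λ p → ⟦<⟧-mono p (1 + y)) R)
                  (trans l₁≡y (sym l₂≡y))))
      where
      distinct : ∀ {p} → ⟦ p < 1 + y ⟧ ≡ ⟦ p < 2 + y ⟧ → p ≢ suc y
      distinct eq refl with () ← trans (sym (⟦<⟧-false {y} {y} ≤-refl))
                                       (trans eq (⟦<⟧-true {y} {suc y} ≤-refl))

  raise : ℕ → ℕ
  raise x = ⟦ suc y ≡ x ⟧ + g x

  private
    raise-at : raise (suc y) ≡ suc (g (suc y))
    raise-at = cong (_+ g (suc y)) (⟦≡⟧-refl y)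

    raise-off : ∀ {x} → x ≢ suc y → raise x ≡ g x
    raise-off {x} x≢ = cong (_+ g x) (⟦≡⟧-false (x≢ ∘ sym))

    raise-y : raise y ≡ g y
    raise-y = raise-off (<⇒≢ ≤-refl)

    raise-2+y : raise (2 + y) ≡ g (2 + y)
    raise-2+y = raise-off (>⇒≢ ≤-refl)

    -- The flat step into `1 + y` and the steep step out of it change places; all other steps are
    -- unaffected.
    raise-step : ∀ {x} → x ≤ n → raise x ≤ raise (suc x) × raise (suc x) ≤ suc (raise x)
    raise-step {x} x≤n with x ≟ y | x ≟ suc y
    ... | yes refl | _ rewrite raise-at | raise-y | flat = n≤1+n _ , ≤-refl
    ... | no _ | yes refl rewrite raise-at | raise-2+y | steep = ≤-refl , n≤1+n _
    ... | no x≢y | no x≢1+y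
      rewrite raise-off x≢1+y | raise-off {suc x} (x≢y ∘ suc-injective) = mono x≤n , lip x≤n

    raise-balance : ∀ {x} → x ≤ n →
      #below (suc x) (positions c′) + raise x ≡ x + raise (suc x)
    raise-balance {x} x≤n = begin
      #below X (positions c′) + (δ₂ + g x)            ≡⟨ cong (_+ (δ₂ + g x)) (#below-c′ X) ⟩
      ⟦ y < X ⟧ + (⟦ 2 + y < X ⟧ + r) + (δ₂ + g x)    ≡⟨ regroup ⟦ y < X ⟧ ⟦ 2 + y < X ⟧ r δ₂ (g x) ⟩
      -- The change in the number of chips to the left of `X` cancels against the change of `g` at
      -- `x` and at `X`.
      ⟦ y < X ⟧ + (⟦ 2 + y < X ⟧ + δ₂) + (r + g x)    ≡⟨ cong (_+ (r + g x)) (⟦<⟧-topple y X) ⟩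
      ⟦ 1 + y < X ⟧ + (⟦ 1 + y < X ⟧ + δ₁) + (r + g x) ≡⟨ sym (regroup ⟦ 1 + y < X ⟧ ⟦ 1 + y < X ⟧ r δ₁ (g x)) ⟩
      ⟦ 1 + y < X ⟧ + (⟦ 1 + y < X ⟧ + r) + (δ₁ + g x) ≡⟨ cong (_+ (δ₁ + g x)) (sym (#below-c X)) ⟩
      #below X (positions c) + (δ₁ + g x)             ≡⟨ x∙yz≈y∙xz (#below X (positions c)) δ₁ (g x) ⟩
      δ₁ + (#below X (positions c) + g x)             ≡⟨ cong (λ z → δ₁ + z) (balance x≤n) ⟩
      δ₁ + (x + g X)                                  ≡⟨ x∙yz≈y∙xz δ₁ x (g X) ⟩
      x + raise X                                     ∎
      where
      open ≡-Reasoning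
      open import Algebra.Properties.CommutativeSemigroup +-commutativeSemigroup using (x∙yz≈y∙xz; interchange)
      X = suc x
      r = #below X R
      -- `δ₁` is the amount by which `raise` exceeds `g` at `X`, and `δ₂` reduces to the amount at
      -- `x`.
      δ₁ = ⟦ 1 + y ≡ X ⟧
      δ₂ = ⟦ 2 + y ≡ X ⟧
      regroup : ∀ a b r d h → a + (b + r) + (d + h) ≡ a + (b + d) + (r + h)
      regroup a b r d h rewrite sym (+-assoc a b r) | sym (+-assoc a b d) = interchange (a + b) r d h

  topple-profile : Profile n s c′ raise
  topple-profile = record
    { labelled = ↭-trans (↭.map⁺ proj₁ after) (↭-trans (↭-sym (↭.map⁺ proj₁ before)) labelled)
    ; inside   = ↭.All-resp-↭ (↭-sym after) (inside′ (↭.All-resp-↭ before inside))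
    ; bottom   = bottom
    ; top      = trans (raise-off (>⇒≢ (s≤s y<n))) top
    ; balance  = raise-balance
    ; mono     = proj₁ ∘ raise-step
    ; lip      = proj₂ ∘ raise-step
    }
    where
    inside′ : All (λ a → proj₂ a ≤ suc n) ((α , suc y) ∷ (β , suc y) ∷ rest) →
              All (λ a → proj₂ a ≤ suc n) ((α , y) ∷ (β , 2 + y) ∷ rest)
    inside′ (_ ∷ _ ∷ rs) = m≤n⇒m≤1+n y≤n ∷ s≤s y<n ∷ rs

  -- For `α` the lower bound stays and the upper one drops by one; for `β` the upper bound on the
  -- label stays and the lower one grows by one. Both losses are paid for by `α < β`, each from the
  -- bound of the other chip.
  topple-admissible : Admissible s g c → Admissible s raise c′
  topple-admissible adm with (p , _) ∷ (q , q′) ∷ rs ← ↭.All-resp-↭ before adm =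
    ↭.All-resp-↭ (↭-sym after) ((p₁ , p₂) ∷ (q₁ , q₂) ∷ All.zipWith keep (elsewhere , rs))
    where
    p₁ : raise y ≤ α
    p₁ rewrite raise-y | sym flat = p
    p₂ : α + raise y ≤ suc s + y
    p₂ rewrite raise-y | sym flat = s≤s⁻¹ (≤-trans (+-monoˡ-≤ (g (suc y)) α<β)
           (≤-trans q′ (≤-reflexive (+-suc (suc s) y))))
    q₁ : raise (2 + y) ≤ β
    q₁ rewrite raise-2+y | steep = ≤-trans (s≤s p) α<β
    q₂ : β + raise (2 + y) ≤ suc s + (2 + y)
    q₂ rewrite raise-2+y | steep | +-suc β (g (suc y)) | +-suc (suc s) (suc y) = s≤s q′
    keep : ∀ {a} → proj₂ a ≢ suc y × (g (proj₂ a) ≤ proj₁ a × proj₁ a + g (proj₂ a) ≤ suc s + proj₂ a) →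
           raise (proj₂ a) ≤ proj₁ a × proj₁ a + raise (proj₂ a) ≤ suc s + proj₂ a
    keep (x≢ , h) rewrite raise-off x≢ = h

  -- The lower bound of `α` and the upper bound of `β` return unchanged. At the common position both
  -- chips face the same two bounds, so `α < β` passes each of these to the other chip.
  untopple-admissible : Admissible s raise c′ → Admissible s g c
  untopple-admissible adm with (p , _) ∷ (q , q′) ∷ rs ← ↭.All-resp-↭ after adm =
    ↭.All-resp-↭ (↭-sym before) ((p₁ , p₂) ∷ (q₁ , q₂) ∷ All.zipWith keep (elsewhere , rs))
    where
    p₁ : g (suc y) ≤ α
    p₁ = ≤-trans (≤-reflexive (trans flat (sym raise-y))) p
    q₂ : β + g (suc y) ≤ suc s + suc y
    q₂ = s≤s⁻¹ (≤-trans (≤-reflexive (trans (sym (+-suc β (g (suc y))))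
           (cong (λ z → β + z) (sym (trans raise-2+y steep)))))
           (≤-trans q′ (≤-reflexive (+-suc (suc s) (suc y)))))
    p₂ : α + g (suc y) ≤ suc s + suc y
    p₂ = ≤-trans (+-monoˡ-≤ _ (<⇒≤ α<β)) q₂
    q₁ : g (suc y) ≤ β
    q₁ = ≤-trans p₁ (<⇒≤ α<β)
    keep : ∀ {a} → proj₂ a ≢ suc y × (raise (proj₂ a) ≤ proj₁ a × proj₁ a + raise (proj₂ a) ≤ suc s + proj₂ a) →
           g (proj₂ a) ≤ proj₁ a × proj₁ a + g (proj₂ a) ≤ suc s + proj₂ a
    keep (x≢ , h) rewrite raise-off x≢ = h

-- Stable configurations

unique-injective : ∀ {A B : Set} {f : A → B} {xs} → Unique (map f xs) →
                   ∀ {x y} → x ∈ xs → y ∈ xs → f x ≡ f y → x ≡ y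
unique-injective _          (here refl) (here refl) _  = refl
unique-injective (p ∷ _)    (here refl) (there y∈)  eq = contradiction eq (All.lookup p (∈-map⁺ _ y∈))
unique-injective (p ∷ _)    (there x∈)  (here refl) eq = contradiction (sym eq) (All.lookup p (∈-map⁺ _ x∈))
unique-injective (_ ∷ uniq) (there x∈)  (there y∈)  eq = unique-injective uniq x∈ y∈ eq

InOrder : Chips → Set
InOrder c = ∀ {α p β q} → (α , p) ∈ c → (β , q) ∈ c → α < β → p < q

step-mono⇒mono : ∀ {n} (g : ℕ → ℕ) → (∀ {x} → x ≤ n → g x ≤ g (suc x)) →
                 ∀ {x y} → x ≤ y → y ≤ suc n → g x ≤ g y
step-mono⇒mono g mono {x} {y} x≤y y≤n with m≤n⇒m<n∨m≡n x≤y
... | inj₂ refl      = ≤-refl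
... | inj₁ (s≤s x≤y) =
  ≤-trans (step-mono⇒mono g mono x≤y (m≤n⇒m≤1+n (s≤s⁻¹ y≤n))) (mono (s≤s⁻¹ y≤n))

unique-labels : ∀ {n s c g} → Profile n s c g → Unique (labels c)
unique-labels {n} P = ↭ₛ.Unique-resp-↭ (setoid ℕ) (↭⇒↭ₛ (↭-sym (Profile.labelled P)))
                        (Unique.map⁺ suc-injective (Unique.upTo⁺ (suc n)))

module Final {n s c g} (P : Profile n s c g) (s≤n : s ≤ n) (stable : Unique (positions c)) where
  open Profile P

  private
    L : ℕ → ℕ
    L x = #below x (positions c)

    climb : ∀ {x y} → x ≤ y → y ≤ suc n → g x ≤ g y
    climb = step-mono⇒mono g mono

    g≤ : ∀ {x} → x ≤ suc n → g x ≤ suc x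
    g≤ {zero}  _   = ≤-reflexive bottom
    g≤ {suc x} x≤n = ≤-trans (lip (s≤s⁻¹ x≤n)) (s≤s (g≤ (m≤n⇒m≤1+n (s≤s⁻¹ x≤n))))

    -- Stability makes g concave.
    flat-suc : ∀ {x} → suc x ≤ n → g x ≡ g (suc x) → g (suc x) ≡ g (2 + x)
    flat-suc {x} x<n flat = ≤-antisym (mono x<n)
      (+-cancelˡ-≤ (suc x) _ _ (≤-trans (≤-reflexive (sym (balance x<n)))
        (+-monoˡ-≤ (g (suc x)) (≤-trans (#below-unique (suc x) stable) (s≤s (≤-reflexive Lx))))))
      where
      Lx : L (suc x) ≡ x
      Lx = +-cancelʳ-≡ (g x) (L (suc x)) x
             (trans (balance (<⇒≤ x<n)) (cong (λ z → x + z) (sym flat)))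

    -- By concavity a flat step is followed by flat steps only, up to `n + 1`, where `top` gives the
    -- value. `d` counts the remaining steps.
    flat-top : ∀ d {x} → d + x ≡ n → g x ≡ g (suc x) → g (suc x) ≡ suc s
    flat-top zero    refl flat = top
    flat-top (suc d) {x} eq flat = trans flat′ (flat-top d (trans (+-suc d x) eq) flat′)
      where
      flat′ = flat-suc (≤-trans (m≤n+m (suc x) d) (≤-reflexive (trans (+-suc d x) eq))) flat

    -- The profile climbs by one from `1` until its first flat step; from there on it has its final
    -- value.
    shape : ∀ {x} → x ≤ suc n → g x ≡ suc x ⊎ g x ≡ suc s
    shape {zero} _ = inj₁ bottom
    shape {suc x} (s≤s x≤n) with shape (m≤n⇒m≤1+n x≤n)
    ... | inj₂ eq = inj₂ (≤-antisym (≤-trans (climb (s≤s x≤n) ≤-refl) (≤-reflexive top))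
                                    (≤-trans (≤-reflexive (sym eq)) (mono x≤n)))
    ... | inj₁ eq with m≤n⇒m<n∨m≡n (mono x≤n)
    ...   | inj₁ steep = inj₁ (≤-antisym (g≤ (s≤s x≤n)) (≤-trans (s≤s (≤-reflexive (sym eq))) steep))
    ...   | inj₂ flat  = inj₂ (flat-top (n ∸ x) (m∸n+n≡m x≤n) flat)

    g-left : ∀ {x} → x ≤ s → g x ≡ suc x
    g-left {x} x≤s with x≤n ← ≤-trans x≤s (m≤n⇒m≤1+n s≤n) with shape x≤n
    ... | inj₁ eq = eq
    ... | inj₂ eq = trans eq (cong suc (≤-antisym (s≤s⁻¹ (subst (_≤ suc x) eq (g≤ x≤n))) x≤s))

    g-right : ∀ {x} → s ≤ x → x ≤ suc n → g x ≡ suc s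
    g-right {x} s≤x x≤n with shape x≤n
    ... | inj₂ eq = eq
    ... | inj₁ eq = trans eq (cong suc (≤-antisym
            (s≤s⁻¹ (≤-trans (≤-reflexive (sym eq)) (≤-trans (climb x≤n ≤-refl) (≤-reflexive top)))) s≤x))

    -- With `g` known, `balance` yields the counts. Together with `L-right` this says that the chips
    -- fill all indices `0, …, n + 1` except `s`.
    L-left : ∀ {x} → x ≤ s → L x ≡ x
    L-left {zero}  _   = #below-zero (positions c)
    L-left {suc x} x<s = +-cancelʳ-≡ (suc x) (L (suc x)) (suc x) (begin
      L (suc x) + suc x  ≡⟨ cong (λ z → L (suc x) + z) (sym (g-left (<⇒≤ x<s))) ⟩
      L (suc x) + g x    ≡⟨ balance (≤-trans (<⇒≤ x<s) s≤n) ⟩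
      x + g (suc x)      ≡⟨ cong (λ z → x + z) (g-left x<s) ⟩
      x + (2 + x)        ≡⟨ +-suc x (suc x) ⟩
      suc x + suc x      ∎)
      where open ≡-Reasoning

    L-right : ∀ {x} → s ≤ x → x ≤ n → L (suc x) ≡ x
    L-right {x} s≤x x≤n = +-cancelʳ-≡ (suc s) (L (suc x)) x (begin
      L (suc x) + suc s  ≡⟨ cong (λ z → L (suc x) + z) (sym (g-right s≤x (m≤n⇒m≤1+n x≤n))) ⟩
      L (suc x) + g x    ≡⟨ balance x≤n ⟩
      x + g (suc x)      ≡⟨ cong (λ z → x + z) (g-right (m≤n⇒m≤1+n s≤x) (s≤s x≤n)) ⟩
      x + suc s          ∎)
      where open ≡-Reasoning

    #labels : ∀ {x} → x ≤ suc n → #below (suc x) (labels c) ≡ x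
    #labels {x} x≤n = trans (#below-↭ (suc x) labelled) (#below-upTo⁺ x≤n)

    ⟦<⟧⁻¹ : ∀ {p x} → ⟦ p < x ⟧ ≡ 1 → p < x
    ⟦<⟧⁻¹ {p} {x} eq with p <? x
    ... | yes p<x = p<x
    ... | no  p≮x with () ← trans (sym eq) (⟦<⟧-false (≮⇒≥ p≮x))

    by-counting : ∀ {x} (h h′ : ℕ × ℕ → ℕ) (X X′ : ℕ) →
      #below X (map h c) ≡ x → #below X′ (map h′ c) ≡ x →
      All (λ a → ⟦ h a < X ⟧ ≤ ⟦ h′ a < X′ ⟧) c → All (λ a → ⟦ h a < X ⟧ ≡ ⟦ h′ a < X′ ⟧) c
    by-counting h h′ X X′ eq eq′ ps = sum-tight ps
      (trans (sym (#below-map X h c)) (trans eq (trans (sym eq′) (#below-map X′ h′ c))))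

    ⟦<⟧-⇒ : ∀ {p x q y} → (p < x → q < y) → ⟦ p < x ⟧ ≤ ⟦ q < y ⟧
    ⟦<⟧-⇒ {p} {x} imp with p <? x
    ... | yes p<x = ≤-trans (⟦<⟧≤1 p x) (≤-reflexive (sym (⟦<⟧-true (imp p<x))))
    ... | no  p≮x = ≤-trans (≤-reflexive (⟦<⟧-false (≮⇒≥ p≮x))) z≤n

  -- Admissibility makes one of the sets {chips left of p}, {chips with the smallest
  -- labels} contain the other, and the two sets have the same size.
  admissible⇒in-order : Admissible s g c → InOrder c
  admissible⇒in-order adm {α} {p} {β} {q} α∈ β∈ α<β with <-cmp p q
  ... | tri< p<q _ _ = p<q
  ... | tri≈ _ p≡q _ = contradiction (cong proj₁ (unique-injective stable α∈ β∈ p≡q)) (<⇒≢ α<β)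
  ... | tri> _ _ q<p with p ≤? s
  ...   | yes p≤s = contradiction α<β (≤⇒≯ (≤-trans (s≤s⁻¹ β≤p) (<⇒≤ (p< α∈ ≤-refl))))
    where
    -- All chips at `p` or further right have labels above `p`, so the labels `1, …, p` lie left of
    -- `p`. Exactly `p` chips lie there, so `β` is one of these labels, whereas `α` exceeds `p`.
    p< : ∀ {v y} → (v , y) ∈ c → p ≤ y → p < v
    p< v∈ p≤y = ≤-trans (≤-reflexive (sym (g-left p≤s)))
      (≤-trans (climb p≤y (All.lookup inside v∈)) (proj₁ (All.lookup adm v∈)))
    β≤p : β < suc p
    β≤p = ⟦<⟧⁻¹ (trans
      (All.lookup (by-counting proj₁ proj₂ (suc p) p
        (#labels (m≤n⇒m≤1+n (≤-trans p≤s s≤n))) (L-left p≤s)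
        (All.tabulate λ v∈ → ⟦<⟧-⇒ λ v≤p → ≰⇒> λ p≤y → <⇒≱ (p< v∈ p≤y) (s≤s⁻¹ v≤p))) β∈)
      (⟦<⟧-true q<p))
  admissible⇒in-order adm {α} {suc p} {β} {q} α∈ β∈ α<β | tri> _ _ q<p | no p≰s =
    contradiction (trans (sym (⟦<⟧-false (≤-refl {suc p})))
                         (trans eq₀ (⟦<⟧-true (<-trans α<β (≤p β∈ q<p))))) λ ()
    where
    s≤p : s ≤ p
    s≤p = s≤s⁻¹ (≰⇒> p≰s)
    p≤n : p ≤ n
    p≤n = s≤s⁻¹ (All.lookup inside α∈)
    -- Here the upper bound acts: it reads `v ≤ s` for `y ≤ s` and `v ≤ y` beyond. So the `p` chips
    -- left of `suc p` carry the labels `1, …, p`, and `α`, which lies at `suc p`, cannot.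
    ≤p : ∀ {v y} → (v , y) ∈ c → y < suc p → v < suc p
    ≤p {v} {y} v∈ (s≤s y≤p) with y ≤? s
    ... | yes y≤s = s≤s (≤-trans (+-cancelʳ-≤ (suc y) v s (≤-trans
                      (≤-reflexive (cong (λ z → v + z) (sym (g-left y≤s))))
                      (≤-trans (proj₂ (All.lookup adm v∈)) (≤-reflexive (sym (+-suc s y)))))) s≤p)
    ... | no  y≰s = s≤s (≤-trans (+-cancelˡ-≤ (suc s) v y (≤-trans
                      (≤-reflexive (trans (+-comm (suc s) v)
                        (cong (λ z → v + z) (sym (g-right (≰⇒≥ y≰s) (All.lookup inside v∈))))))
                      (proj₂ (All.lookup adm v∈)))) y≤p)
    eq₀ : ⟦ suc p < suc p ⟧ ≡ ⟦ α < suc p ⟧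
    eq₀ = All.lookup (by-counting proj₂ proj₁ (suc p) (suc p)
            (L-right s≤p p≤n) (#labels (m≤n⇒m≤1+n p≤n))
            (All.tabulate λ v∈ → ⟦<⟧-⇒ (≤p v∈))) α∈

  -- In a sorted configuration the chip labelled `suc v` has exactly `v` chips to its left. The
  -- known counts then give `v ≡ x` for `x < s` and `suc v ≡ x` for `x > s`, and one of the two
  -- bounds is attained.
  in-order⇒admissible : InOrder c → Admissible s g c
  in-order⇒admissible ord = All.tabulate λ {a} a∈ → bounds (proj₁ a) (proj₂ a) a∈
    where
    module _ (v x : ℕ) (v∈ : (suc v , x) ∈ c) (v≤n : v ≤ n) where
      same : ∀ {a} → a ∈ c → ⟦ proj₂ a < x ⟧ ≡ ⟦ proj₁ a < suc v ⟧
      same {w , y} w∈ with <-cmp w (suc v)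
      ... | tri< w<v _ _ = trans (⟦<⟧-true (ord w∈ v∈ w<v)) (sym (⟦<⟧-true w<v))
      ... | tri> _ _ v<w = trans (⟦<⟧-false (<⇒≤ (ord v∈ w∈ v<w))) (sym (⟦<⟧-false (<⇒≤ v<w)))
      ... | tri≈ _ w≡v _ with refl ← unique-injective (unique-labels P) w∈ v∈ w≡v =
        trans (⟦<⟧-false {x} ≤-refl) (sym (⟦<⟧-false {v} ≤-refl))

      Lx≡v : L x ≡ v
      Lx≡v = trans (#below-map x proj₂ c)
        (trans (cong sum (map-cong-local (All.tabulate same)))
        (trans (sym (#below-map (suc v) proj₁ c)) (#labels (m≤n⇒m≤1+n v≤n))))

      L1+x≥1+v : suc v ≤ L (suc x)
      L1+x≥1+v = ≤∧≢⇒< (≤-trans (≤-reflexive (sym Lx≡v)) (#below-mono x (positions c)))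
        λ v≡L → contradiction
          (trans (sym (⟦<⟧-false {x} ≤-refl))
            (trans (All.lookup (sum-tight {f = λ a → ⟦ proj₂ a < x ⟧} {g = λ a → ⟦ proj₂ a < suc x ⟧}
                     (All.tabulate λ {a} _ → ⟦<⟧-mono (proj₂ a) x)
                     (trans (sym (#below-map x proj₂ c)) (trans Lx≡v (trans v≡L (#below-map (suc x) proj₂ c))))) v∈)
                   (⟦<⟧-true {x} ≤-refl)))
          λ ()

      bounds′ : g x ≤ suc v × suc v + g x ≤ suc s + x
      bounds′ with <-cmp x s
      ... | tri< x<s _ _ rewrite trans (sym Lx≡v) (L-left (<⇒≤ x<s)) | g-left (<⇒≤ x<s) =
        ≤-refl , ≤-trans (+-monoˡ-≤ (suc x) x<s) (≤-reflexive (+-suc s x))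
      -- The index `s` is the vacant one: `L s` and `L (suc s)` agree, although the chip at hand
      -- would separate them.
      ... | tri≈ _ refl _ = contradiction L1+x≥1+v (<⇒≱ (s≤s (≤-reflexive
              (trans (L-right ≤-refl s≤n) (trans (sym (L-left ≤-refl)) Lx≡v)))))
      ... | tri> _ _ s<x with s≤s s≤x ← s<x
        rewrite trans (sym Lx≡v) (L-right s≤x (s≤s⁻¹ (All.lookup inside v∈)))
              | g-right (m≤n⇒m≤1+n s≤x) (All.lookup inside v∈) =
        s≤s s≤x , ≤-reflexive (+-comm _ (suc s))

    bounds : ∀ v x → (v , x) ∈ c → g x ≤ v × v + g x ≤ suc s + x
    bounds v x v∈ with ∈-map⁻ suc (↭.∈-resp-↭ labelled (∈-map⁺ proj₁ v∈))
    ... | v , v<n , refl = bounds′ v x v∈ (s≤s⁻¹ (∈-upTo⁻ v<n))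

-- Termination and coordinates

#chips : ∀ {n s c g} → Profile n s c g → length c ≡ suc n
#chips {n} {c = c} P = trans (sym (length-map proj₁ c)) (trans (↭.↭-length (Profile.labelled P))
  (trans (length-map suc (upTo (suc n))) (length-upTo (suc n))))

-- Topplings never have to leave `L_n`. At index `0`, `balance` and `lip` allow one chip only; at
-- `n + 1`, `mono` leaves at least `n` of the `n + 1` chips further left.
crowded : ∀ {n s c g x R} → Profile n s c g → positions c ↭ x ∷ x ∷ R → ∃ λ y → x ≡ suc y × y < n
crowded {c = c} {g} {zero} {R} P at-x =
  contradiction (+-cancelʳ-≤ (g 0) _ 1 (≤-trans (≤-reflexive (balance z≤n)) (lip z≤n)))
    (<⇒≱ (≤-trans (s≤s (s≤s z≤n)) (≤-reflexive (sym (#below-↭ 1 at-x)))))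
  where open Profile P
crowded {n} {c = c} {g} {suc y} {R} P at-x with y <? n
... | yes y<n = y , refl , y<n
... | no  y≮n with inside-x ∷ _ ← ↭.All-resp-↭ at-x (All.map⁺ (Profile.inside P))
              with refl ← ≤-antisym (s≤s⁻¹ inside-x) (≮⇒≥ y≮n) =
  contradiction (begin-strict
    y                            ≤⟨ +-cancelʳ-≤ (g y) y _ (≤-trans (+-monoʳ-≤ y (mono ≤-refl))
                                      (≤-reflexive (sym (balance ≤-refl)))) ⟩
    #below (suc y) (positions c) ≡⟨ #below-↭ (suc y) at-x ⟩
    ⟦ y < y ⟧ + (⟦ y < y ⟧ + #below (suc y) R)
                                 ≡⟨ cong (λ b → b + (b + #below (suc y) R)) (⟦<⟧-false {y} ≤-refl) ⟩
    #below (suc y) R             ≤⟨ #below≤length (suc y) R ⟩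
    length R                     <⟨ ≤-refl ⟩
    suc (length R)               ≡⟨ suc-injective (trans (sym (↭.↭-length at-x))
                                      (trans (length-map proj₂ c) (#chips P))) ⟩
    y                            ∎) (<-irrefl refl)
  where
  open Profile P
  open ≤-Reasoning

energy : Chips → ℕ
energy c = sum (map (λ a → proj₂ a * proj₂ a) c)

-- This is `(x − 1)² + (x + 1)² = 2x² + 2`. As the energy is bounded, the process terminates.
energy-topple : ∀ {n c c′} → Topple n c c′ → energy c′ ≡ 2 + energy c
energy-topple {c = c} {c′} T = begin
  energy c′                                             ≡⟨ sum-↭ (↭.map⁺ _ after) ⟩
  y * y + ((2 + y) * (2 + y) + energy rest)             ≡⟨ squares y (energy rest) ⟩
  2 + (suc y * suc y + (suc y * suc y + energy rest))   ≡⟨ cong (λ e → 2 + e) (sym (sum-↭ (↭.map⁺ _ before))) ⟩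
  2 + energy c                                          ∎
  where
  open Topple T
  open ≡-Reasoning
  squares : ∀ y e → y * y + ((2 + y) * (2 + y) + e) ≡ 2 + (suc y * suc y + (suc y * suc y + e))
  squares = solve-∀

energy-bound : ∀ {m c} → All (λ a → proj₂ a ≤ m) c → energy c ≤ length c * (m * m)
energy-bound []       = z≤n
energy-bound (p ∷ ps) = +-mono-≤ (*-mono-≤ p p) (energy-bound ps)

half-suc-suc : ∀ n → suc (suc n) / 2 ≡ suc (n / 2)
half-suc-suc n = m/n≡1+[m∸n]/n {suc (suc n)} {2} (s≤s (s≤s z≤n))

halves : ∀ n → n / 2 + suc n / 2 ≡ n
halves zero    = refl
halves (suc n) = begin
  suc n / 2 + suc (suc n) / 2  ≡⟨ cong (λ h → suc n / 2 + h) (half-suc-suc n) ⟩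
  suc n / 2 + suc (n / 2)      ≡⟨ +-suc (suc n / 2) (n / 2) ⟩
  suc (suc n / 2 + n / 2)      ≡⟨ cong suc (+-comm (suc n / 2) (n / 2)) ⟩
  suc (n / 2 + suc n / 2)      ≡⟨ cong suc (halves n) ⟩
  suc n                        ∎
  where open ≡-Reasoning

-- The absolute value makes the shift total; it is the true shift wherever `InL` holds, since the
-- sum is nonnegative there.
index : ℕ → ℤ → ℕ
index n p = ∣ p ℤ.+ + (suc n / 2) ∣

chips : ℕ → Config → Chips
chips n = map λ (α , p) → α , index n p

module Coordinates (n : ℕ) where
  private
    A : ℤ
    A = + (suc n / 2)

  InL⇒index : ∀ {p} → InL n p → p ℤ.+ A ≡ + index n p
  InL⇒index {p} (l , _) = sym (ℤ.0≤i⇒+∣i∣≡i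
    (subst (ℤ._≤ p ℤ.+ A) (ℤ.+-inverseˡ A) (ℤ.+-monoˡ-≤ A l)))

  shift-back : ∀ {p z} → p ℤ.+ A ≡ z → p ≡ z ℤ.- A
  shift-back {p} refl = back p A
    where
    back : ∀ p a → p ≡ p ℤ.+ a ℤ.- a
    back = ℤ.solve-∀

  position : ∀ {p} → InL n p → p ≡ + index n p ℤ.- A
  position inL = shift-back (InL⇒index inL)

  index≤ : ∀ {p} → InL n p → index n p ≤ suc n
  index≤ {p} inL@(_ , u) = ℤ.drop‿+≤+ (subst₂ ℤ._≤_ (InL⇒index inL) (cong (+_ ∘ suc) (halves n))
    (ℤ.+-monoˡ-≤ A u))

  index⇒InL : ∀ {p x} → p ℤ.+ A ≡ + x → x ≤ suc n → InL n p
  index⇒InL {p} {x} eq x≤ with refl ← shift-back {p} eq =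
      subst (ℤ._≤ + x ℤ.- A) (ℤ.+-identityˡ (- A)) (ℤ.+-monoˡ-≤ (- A) (ℤ.+≤+ z≤n))
    , ℤ.≤-trans (ℤ.+-monoˡ-≤ (- A) (ℤ.+≤+ (≤-trans x≤ (≤-reflexive (sym (cong suc (halves n)))))))
                (ℤ.≤-reflexive (sym (shift-back refl)))

  index-< : ∀ {p q} → InL n p → InL n q → p ℤ.< q → index n p < index n q
  index-< P Q p<q = ℤ.drop‿+<+ (subst₂ ℤ._<_ (InL⇒index P) (InL⇒index Q) (ℤ.+-monoˡ-< A p<q))

  index-<⁻¹ : ∀ {p q} → InL n p → InL n q → index n p < index n q → p ℤ.< q
  index-<⁻¹ P Q x<y = subst₂ ℤ._<_ (sym (position P)) (sym (position Q)) (ℤ.+-monoˡ-< (- A) (ℤ.+<+ x<y))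

  index-around : ∀ {i y} → i ℤ.+ A ≡ + suc y →
    (i ℤ.- + 1) ℤ.+ A ≡ + y × (i ℤ.+ + 1) ℤ.+ A ≡ + (2 + y)
  index-around {i} {y} eq =
      trans (ring₁ i A) (cong (ℤ._- + 1) eq)
    , trans (ring₂ i A) (trans (cong (ℤ._+ + 1) eq) (cong (λ z → + suc z) (+-comm y 1)))
    where
    ring₁ : ∀ i a → i ℤ.- + 1 ℤ.+ a ≡ i ℤ.+ a ℤ.- + 1
    ring₁ = ℤ.solve-∀
    ring₂ : ∀ i a → i ℤ.+ + 1 ℤ.+ a ≡ i ℤ.+ a ℤ.+ + 1
    ring₂ = ℤ.solve-∀

  index-suc : ∀ {i y} → (i ℤ.- + 1) ℤ.+ A ≡ + y → i ℤ.+ A ≡ + suc y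
  index-suc {i} {y} eq =
    trans (ring i A) (trans (cong (ℤ._+ + 1) eq) (cong (+_) (+-comm y 1)))
    where
    ring : ∀ i a → i ℤ.+ a ≡ i ℤ.- + 1 ℤ.+ a ℤ.+ + 1
    ring = ℤ.solve-∀

-- Moves

setAt-↭ : ∀ c (j : Fin (length c)) → ∃ λ rest →
  c ↭ lookup c j ∷ rest × (∀ y → setAt c (toℕ j) y ↭ y ∷ rest)
setAt-↭ (x ∷ c) zero    = c , ↭-refl , λ _ → ↭-refl
setAt-↭ (x ∷ c) (suc j) with rest , p , q ← setAt-↭ c j =
  x ∷ rest , ↭-trans (prep x p) (swap _ _ ↭-refl) , λ y → ↭-trans (prep x (q y)) (swap _ _ ↭-refl)

-- The same `rest` serves before and after the update and for all new values, so a move becomes a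
-- replacement of two chips up to reordering.
setAt₂-↭ : ∀ c (j k : Fin (length c)) → j ≢ k → ∃ λ rest →
  c ↭ lookup c j ∷ lookup c k ∷ rest ×
  (∀ y z → setAt (setAt c (toℕ j) y) (toℕ k) z ↭ y ∷ z ∷ rest)
setAt₂-↭ (x ∷ c) zero    zero    j≢k = contradiction refl j≢k
setAt₂-↭ (x ∷ c) zero    (suc k) _   with rest , p , q ← setAt-↭ c k =
  rest , prep x p , λ y z → prep y (q z)
setAt₂-↭ (x ∷ c) (suc j) zero    _   with rest , p , q ← setAt-↭ c j =
    rest , ↭-trans (prep x p) (swap _ _ ↭-refl)
  , λ y z → ↭-trans (prep z (q y)) (swap _ _ ↭-refl)
setAt₂-↭ (x ∷ c) (suc j) (suc k) j≢k with rest , p , q ← setAt₂-↭ c j k (j≢k ∘ cong suc) =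
  x ∷ rest , rotate p , λ y z → rotate (q y z)
  where
  rotate : ∀ {u v c′ rest} → c′ ↭ u ∷ v ∷ rest → x ∷ c′ ↭ u ∷ v ∷ x ∷ rest
  rotate p = ↭-trans (prep x p) (↭-trans (swap _ _ ↭-refl) (prep _ (swap _ _ ↭-refl)))

stable⊎clash : ∀ (c : Config) → Stable c ⊎
  ∃ λ j → ∃ λ k → j ≢ k × proj₂ (lookup c j) ≡ proj₂ (lookup c k)
stable⊎clash [] = inj₁ []
stable⊎clash (x ∷ c) with Any.any? (λ y → proj₂ x ℤ.≟ proj₂ y) c | stable⊎clash c
... | yes same  | _ = inj₂ (zero , suc (Any.index same) , (λ ()) , Any.lookup-index same)
... | no  alone | inj₁ st = inj₁ (All.map⁺ (All.¬Any⇒All¬ c alone) ∷ st)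
... | no  alone | inj₂ (j , k , j≢k , eq) = inj₂ (suc j , suc k , j≢k ∘ suc-injectiveᶠ , eq)

-- Runs of the process and the sorting criterion

module Dynamics (n s : ℕ) where
  open Coordinates n

  chip : ℕ × ℤ → ℕ × ℕ
  chip (α , p) = α , index n p

  -- The left target lies in `L_n`, so the index of `i` is a successor; the right target does too,
  -- which gives `y < n`. The two list places differ because the labels do.
  move⇒topple : ∀ {c c′} → Move n c c′ → Topple n (chips n c) (chips n c′)
  move⇒topple {c} (topple j k α β i eqⱼ eqₖ α<β inL′)
    with setAt₂-↭ c j k (λ { refl → <-irrefl (cong proj₁ (trans (sym eqⱼ) eqₖ)) α<β })
  ... | rest , before , after = record
    { α<β    = α<β
    ; y<n    = s≤s⁻¹ (subst (_≤ suc n) (cong ∣_∣ at-i+1) (index≤ inR))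
    ; before = subst₂ (λ a b → chips n c ↭ a ∷ b ∷ chips n rest)
                 (trans (cong chip eqⱼ) (cong (α ,_) (cong ∣_∣ at-i)))
                 (trans (cong chip eqₖ) (cong (β ,_) (cong ∣_∣ at-i)))
                 (↭.map⁺ chip before)
    ; after  = subst (λ x →
                   chips n (setAt (setAt c (toℕ j) (α , i ℤ.- + 1)) (toℕ k) (β , i ℤ.+ + 1)) ↭
                   (α , index n (i ℤ.- + 1)) ∷ (β , x) ∷ chips n rest)
                 (cong ∣_∣ at-i+1) (↭.map⁺ chip (after (α , i ℤ.- + 1) (β , i ℤ.+ + 1)))
    }
    where
    inLeft : InL n (i ℤ.- + 1)
    inLeft = inL′ (↭.∈-resp-↭ (↭-sym (after _ _)) (here refl))
    inR : InL n (i ℤ.+ + 1)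
    inR = inL′ (↭.∈-resp-↭ (↭-sym (after _ _)) (there (here refl)))
    at-i : i ℤ.+ + (suc n / 2) ≡ + suc (index n (i ℤ.- + 1))
    at-i = index-suc {i} (InL⇒index inLeft)
    at-i+1 : i ℤ.+ + 1 ℤ.+ + (suc n / 2) ≡ + (2 + index n (i ℤ.- + 1))
    at-i+1 = proj₂ (index-around {i} at-i)

  move-inL : ∀ {c c′} → Move n c c′ → AllInL n c′
  move-inL (topple _ _ _ _ _ _ _ _ inL′) = inL′

  -- Admissibility is carried along an arbitrary run in both directions, whatever choices were made.
  follow : ∀ {c c′ g} → Star (Move n) c c′ → AllInL n c → Profile n s (chips n c) g →
    ∃ λ g′ → AllInL n c′ × Profile n s (chips n c′) g′ ×
      (Admissible s g (chips n c) → Admissible s g′ (chips n c′)) ×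
      (Admissible s g′ (chips n c′) → Admissible s g (chips n c))
  follow ε        inL P = _ , inL , P , id , id
  follow (m ◅ ms) inL P
    with T ← move⇒topple m
    with g′ , inL′ , P′ , to , from ← follow ms (move-inL m) (topple-profile P T) =
    g′ , inL′ , P′ , to ∘ topple-admissible P T , untopple-admissible P T ∘ from

  stable⇒unique : ∀ {c} → AllInL n c → Stable c → Unique (positions (chips n c))
  stable⇒unique {c} inL st = Unique.map⁻ {f = λ x → + x ℤ.- + (suc n / 2)} (subst Unique (sym eq) st)
    where
    eq : map (λ x → + x ℤ.- + (suc n / 2)) (positions (chips n c)) ≡ map proj₂ c
    eq = trans (cong (map _) (sym (map-∘ c))) (trans (sym (map-∘ c))
           (map-cong-local (All.tabulate λ a∈ → sym (position (inL a∈)))))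

  in-order : ∀ {c} → AllInL n c → ReadsIdentity c → InOrder (chips n c)
  in-order inL ri α∈ β∈ α<β with ∈-map⁻ chip α∈ | ∈-map⁻ chip β∈
  ... | _ , α∈c , refl | _ , β∈c , refl = index-< (inL α∈c) (inL β∈c) (ri α∈c β∈c α<β)

  reads-identity : ∀ {c} → AllInL n c → InOrder (chips n c) → ReadsIdentity c
  reads-identity inL ord α∈ β∈ α<β =
    index-<⁻¹ (inL α∈) (inL β∈) (ord (∈-map⁺ chip α∈) (∈-map⁺ chip β∈) α<β)

  -- Labels are distinct, so the comparison decides which chip goes left; `crowded` puts both
  -- targets inside `L_n`.
  clash⇒move : ∀ {c g} → AllInL n c → Profile n s (chips n c) g →
    ∀ {j k} → j ≢ k → proj₂ (lookup c j) ≡ proj₂ (lookup c k) → ∃ (Move n c)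
  clash⇒move {c} inL P {j} {k} j≢k same = by-label (<-cmp (proj₁ (lookup c j)) (proj₁ (lookup c k)))
    where
    ordered : ∀ j k → j ≢ k → proj₂ (lookup c k) ≡ proj₂ (lookup c j) →
              proj₁ (lookup c j) < proj₁ (lookup c k) → ∃ (Move n c)
    ordered j k j≢k same α<β with setAt₂-↭ c j k j≢k
    ... | rest , before , after with crowded {R = positions (chips n rest)} P
          (subst (λ p → positions (chips n c) ↭ index n (proj₂ (lookup c j)) ∷ index n p ∷ positions (chips n rest))
             same (↭.map⁺ proj₂ (↭.map⁺ chip before)))
    ... | y , eq , y<n = _ , topple j k _ _ i refl (cong (_ ,_) same) α<β
            λ a∈ → inL′ (↭.∈-resp-↭ (after _ _) a∈)
      where
      i : ℤ
      i = proj₂ (lookup c j)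
      at-i : i ℤ.+ + (suc n / 2) ≡ + suc y
      at-i = trans (InL⇒index (inL (∈-lookup {xs = c} j))) (cong (+_) eq)
      inL′ : ∀ {α p} → (α , p) ∈ (_ , i ℤ.- + 1) ∷ (_ , i ℤ.+ + 1) ∷ rest → InL n p
      inL′ (here refl)         = index⇒InL (proj₁ (index-around {i} at-i)) (<⇒≤ (m≤n⇒m≤1+n y<n))
      inL′ (there (here refl)) = index⇒InL (proj₂ (index-around {i} at-i)) (s≤s y<n)
      inL′ (there (there a∈))  = inL (↭.∈-resp-↭ (↭-sym before) (there (there a∈)))

    by-label : _ → ∃ (Move n c)
    by-label (tri< α<β _ _) = ordered j k j≢k (sym same) α<β
    by-label (tri> _ _ β<α) = ordered k j (j≢k ∘ sym) same β<α
    by-label (tri≈ _ α≡β _) with setAt₂-↭ c j k j≢k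
    ... | _ , before , _ with (α≢β ∷ _) ∷ _ ← ↭ₛ.Unique-resp-↭ (setoid ℕ)
            (↭⇒↭ₛ (↭.map⁺ proj₁ (↭.map⁺ chip before))) (unique-labels P) = contradiction α≡β α≢β

  -- `d` is fuel bounding the distance to the maximal energy: `n + 1` chips, each of index at most
  -- `n + 1`. A move costs one unit and gains energy two; with no fuel left it would exceed the
  -- maximum.
  stabilise : ∀ d {c g} → AllInL n c → Profile n s (chips n c) g →
    suc n * (suc n * suc n) ≤ d + energy (chips n c) → ∃ λ c′ → Star (Move n) c c′ × Stable c′
  stabilise d {c} inL P bound with stable⊎clash c
  ... | inj₁ st = c , ε , st
  ... | inj₂ (j , k , j≢k , same) with c′ , m ← clash⇒move inL P j≢k same
    with d | move⇒topple m
  ...   | zero  | T = contradiction bound (<⇒≱ (begin-strict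
          energy (chips n c)         <⟨ n<1+n _ ⟩
          suc (energy (chips n c))   ≤⟨ n≤1+n _ ⟩
          2 + energy (chips n c)     ≡⟨ energy-topple T ⟨
          energy (chips n c′)        ≤⟨ energy-bound (Profile.inside P′) ⟩
          length (chips n c′) * (suc n * suc n) ≡⟨ cong (_* (suc n * suc n)) (#chips P′) ⟩
          suc n * (suc n * suc n)    ∎))
    where
    open ≤-Reasoning
    P′ = topple-profile P T
  ...   | suc d | T with c″ , ms , st ← stabilise d (move-inL m) (topple-profile P T)
            (≤-trans bound (≤-trans (≤-reflexive (sym (+-suc d _)))
              (+-monoʳ-≤ d (≤-trans (n≤1+n _) (≤-reflexive (sym (energy-topple T))))))) =
    c″ , m ◅ ms , st

  Sorts : Config → Set
  Sorts c = ∃ λ c′ → Star (Move n) c c′ × Stable c′ × ReadsIdentity c′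

  -- From left to right, admissibility at the sorted end is pulled back along the given run.
  -- Conversely `stabilise` supplies a run, whose end inherits admissibility and is therefore
  -- sorted.
  sorts⇔admissible : ∀ {c g} → s ≤ n → AllInL n c → Profile n s (chips n c) g →
    Sorts c ⇔ Admissible s g (chips n c)
  sorts⇔admissible {c} {g} s≤n inL P = mk⇔ to from
    where
    to : Sorts c → Admissible s g (chips n c)
    to (c′ , ms , st , ri) with g′ , inL′ , P′ , _ , back ← follow ms inL P =
      back (Final.in-order⇒admissible P′ s≤n (stable⇒unique inL′ st) (in-order inL′ ri))
    from : Admissible s g (chips n c) → Sorts c
    from adm with c′ , ms , st ← stabilise (suc n * (suc n * suc n)) inL P (m≤m+n _ _)
             with g′ , inL′ , P′ , forth , _ ← follow ms inL P =
      c′ , ms , st , reads-identity inL′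
        (Final.admissible⇒in-order P′ s≤n (stable⇒unique inL′ st) (forth adm))

-- The initial configuration

-- `chipsFrom` in indices: the shift by `1 + k`, with `k = (n ∸ 1) / 2`, takes the position `−k + j`
-- to `suc j`.
row : ℕ → ℕ → List ℕ → Chips
row r j []       = []
row r j (x ∷ xs) = (relabel r x , suc j) ∷ row r (suc j) xs

labels-row : ∀ r j xs → labels (row r j xs) ≡ map (relabel r) xs
labels-row r j []       = refl
labels-row r j (x ∷ xs) = cong (relabel r x ∷_) (labels-row r (suc j) xs)

positions-row-suc : ∀ r j xs → positions (row r (suc j) xs) ≡ map suc (positions (row r j xs))
positions-row-suc r j []       = refl
positions-row-suc r j (x ∷ xs) = cong (2 + j ∷_) (positions-row-suc r (suc j) xs)

upTo-suc : ∀ n → upTo (suc n) ≡ 0 ∷ map suc (upTo n)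
upTo-suc n = cong (0 ∷_) (sym (map-upTo suc n))

positions-row : ∀ r xs → positions (row r 0 xs) ≡ map suc (upTo (length xs))
positions-row r []       = refl
positions-row r (x ∷ xs) = trans
  (cong (1 ∷_) (trans (positions-row-suc r 0 xs) (cong (map suc) (positions-row r xs))))
  (cong (map suc) (sym (upTo-suc (length xs))))

All-row⁺ : ∀ {P : ℕ × ℕ → Set} r j xs →
  (∀ i → i < length xs → P (relabel r (entry xs i) , suc (j + i))) → All P (row r j xs)
All-row⁺ r j []       h = []
All-row⁺ {P} r j (x ∷ xs) h =
  subst (λ i → P (relabel r x , suc i)) (+-identityʳ j) (h 0 (s≤s z≤n)) ∷
  All-row⁺ r (suc j) xs λ i i<n →
    subst (λ l → P (relabel r (entry xs i) , suc l)) (+-suc j i) (h (suc i) (s≤s i<n))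

All-row⁻ : ∀ {P : ℕ × ℕ → Set} r j xs → All P (row r j xs) →
  ∀ i → i < length xs → P (relabel r (entry xs i) , suc (j + i))
All-row⁻ {P} r j (x ∷ xs) (p ∷ ps) zero _ =
  subst (λ i → P (relabel r x , suc i)) (sym (+-identityʳ j)) p
All-row⁻ {P} r j (x ∷ xs) (p ∷ ps) (suc i) (s≤s i<n) =
  subst (λ l → P (relabel r (entry xs i) , suc l)) (sym (+-suc j i)) (All-row⁻ r (suc j) xs ps i i<n)

relabel-suc : ∀ r x → relabel (suc r) (suc x) ≡ suc (relabel r x)
relabel-suc r x with x <ᵇ r
... | true  = refl
... | false = refl

relabel-< : ∀ {r x} → x < r → relabel r x ≡ x
relabel-< {suc r} {zero}  _         = refl
relabel-< {suc r} {suc x} (s≤s x<r) = trans (relabel-suc r x) (cong suc (relabel-< x<r))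

relabel-≥ : ∀ {r x} → r ≤ x → relabel r x ≡ suc x
relabel-≥ {zero}          _         = refl
relabel-≥ {suc r} {suc x} (s≤s r≤x) = trans (relabel-suc r x) (cong suc (relabel-≥ r≤x))

relabel-cases : ∀ r x → relabel r x ≡ x ⊎ relabel r x ≡ suc x
relabel-cases r x with <-≤-connex x r
... | inj₁ x<r = inj₁ (relabel-< x<r)
... | inj₂ r≤x = inj₂ (relabel-≥ r≤x)

map-relabel-suc : ∀ r ℓ → map (relabel (suc r)) (map suc ℓ) ≡ map suc (map (relabel r) ℓ)
map-relabel-suc r ℓ = trans (sym (map-∘ ℓ)) (trans (map-cong (relabel-suc r) ℓ) (map-∘ ℓ))

relabel-↭ : ∀ {r n} → r ≤ n → r ∷ map (relabel r) (upTo n) ↭ upTo (suc n)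
relabel-↭ {zero}  {n}     _         = ↭-reflexive (sym (upTo-suc n))
relabel-↭ {suc r} {suc n} (s≤s r≤n) = begin
  suc r ∷ map (relabel (suc r)) (upTo (suc n))          ≡⟨ cong (λ ℓ → suc r ∷ map (relabel (suc r)) ℓ) (upTo-suc n) ⟩
  suc r ∷ 0 ∷ map (relabel (suc r)) (map suc (upTo n))  ≡⟨ cong (λ ℓ → suc r ∷ 0 ∷ ℓ) (map-relabel-suc r (upTo n)) ⟩
  suc r ∷ 0 ∷ map suc (map (relabel r) (upTo n))        ↭⟨ swap (suc r) 0 ↭-refl ⟩
  0 ∷ map suc (r ∷ map (relabel r) (upTo n))            ↭⟨ prep 0 (↭.map⁺ suc (relabel-↭ r≤n)) ⟩
  0 ∷ map suc (upTo (suc n))                            ≡⟨ upTo-suc (suc n) ⟨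
  upTo (suc (suc n))                                    ∎
  where open PermutationReasoning

∸-suc : ∀ a x → suc x ∸ a ≡ ⟦ a < suc x ⟧ + (x ∸ a)
∸-suc zero    x       = refl
∸-suc (suc a) zero    = 0∸n≡0 a
∸-suc (suc a) (suc x) = ∸-suc a x

entry-∈ : ∀ {xs i} → i < length xs → entry xs i ∈ xs
entry-∈ {x ∷ xs} {zero}  _         = here refl
entry-∈ {x ∷ xs} {suc i} (s≤s i<n) = there (entry-∈ i<n)

entry-bounds : ∀ {n xs i} → IsPerm n xs → i < length xs → 1 ≤ entry xs i × entry xs i ≤ n
entry-bounds perm i<n with ∈-map⁻ suc (↭.∈-resp-↭ perm (entry-∈ i<n))
... | e , e∈ , eq rewrite eq = s≤s z≤n , ∈-upTo⁻ e∈

-- For a chip at the position p this is πᵢ − n ≤ p ≤ πᵢ − 1.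
Banded : ℕ → List ℕ → Set
Banded n w = ∀ i → i < n → suc i ≤ entry w i + k × entry w i + k ≤ n + i
  where k = (n ∸ 1) / 2

-- Admissibility of the label `v` at index `suc i` for `s = suc b` and the initial profile, whose
-- value there is `suc (i ∸ k)`.
Inserted : ℕ → ℕ → ℕ → ℕ → Set
Inserted k b v i = suc (i ∸ k) ≤ v × v + suc (i ∸ k) ≤ 2 + b + suc i

-- Valid for every inserted label, since the worse of `e` and `suc e` is taken in each bound: `e` in
-- the lower, `suc e` in the upper. The upper bound comes from the band if `i ≤ k` and from `e ≤ n`
-- if `k ≤ i`.
banded⇒inserted : ∀ {n k b e v i} → n ≡ suc (b + k) → 1 ≤ e → e ≤ n → v ≡ e ⊎ v ≡ suc e →
  suc i ≤ e + k → e + k ≤ n + i → Inserted k b v i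
banded⇒inserted {k = k} {b} {suc e} {v} {i} refl _ e≤n v≡ lo hi =
    ≤-trans (m<n+o⇒m∸n<o i k (≤-trans lo (≤-reflexive (+-comm (suc e) k)))) (e≤v v≡)
  , ≤-trans (+-monoˡ-≤ (suc (i ∸ k)) (v≤1+e v≡)) (≤-trans (≤-reflexive (+-suc (2 + e) (i ∸ k)))
      (s≤s (s≤s shifted)))
  where
  e≤v : v ≡ suc e ⊎ v ≡ 2 + e → suc e ≤ v
  e≤v (inj₁ refl) = ≤-refl
  e≤v (inj₂ refl) = n≤1+n _
  v≤1+e : v ≡ suc e ⊎ v ≡ 2 + e → v ≤ 2 + e
  v≤1+e (inj₁ refl) = n≤1+n _
  v≤1+e (inj₂ refl) = ≤-refl
  shifted : suc e + (i ∸ k) ≤ b + suc i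
  shifted with ≤-total i k
  ... | inj₁ i≤k rewrite m≤n⇒m∸n≡0 i≤k | +-identityʳ e | +-suc b i =
    +-cancelʳ-≤ k (suc e) (suc (b + i)) (≤-trans hi (≤-reflexive (swap-last b k i)))
    where
    swap-last : ∀ b k i → suc (b + k) + i ≡ suc (b + i) + k
    swap-last = solve-∀
  ... | inj₂ k≤i = ≤-trans (+-monoˡ-≤ (i ∸ k) e≤n)
    (≤-reflexive (trans (cong suc (trans (+-assoc b k (i ∸ k)) (cong (λ z → b + z) (m+[n∸m]≡n k≤i)))) (sym (+-suc b i))))

-- Here `suc b` is `n − k`. An entry below `r` keeps its label, hence its lower bound, and is at
-- most `n − k`, which implies the upper one. An entry from `r` on is at least `n − k`, which
-- implies the lower bound, and its raised label gives the upper one. Both choices of `r` separate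
-- the entries in this way.
inserted⇒banded : ∀ {n k b e r i} → n ≡ suc (b + k) → i < n → r ≡ suc b ⊎ r ≡ 2 + b →
  Inserted k b (relabel r e) i → suc i ≤ e + k × e + k ≤ n + i
inserted⇒banded {k = k} {b} {e} {r} {i} refl i<n r≡ (lo , hi) with <-≤-connex e r
... | inj₁ e<r rewrite relabel-< e<r =
    ≤-trans (s≤s (m≤n+m∸n i k)) (≤-trans (≤-reflexive (sym (+-suc k (i ∸ k))))
      (≤-trans (+-monoʳ-≤ k lo) (≤-reflexive (+-comm k e))))
  , ≤-trans (+-monoˡ-≤ k (s≤s⁻¹ (≤-trans e<r (r≤ r≡)))) (m≤m+n _ i)
  where
  r≤ : r ≡ suc b ⊎ r ≡ 2 + b → r ≤ 2 + b
  r≤ (inj₁ refl) = n≤1+n _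
  r≤ (inj₂ refl) = ≤-refl
... | inj₂ r≤e rewrite relabel-≥ r≤e =
    ≤-trans i<n (+-monoˡ-≤ k (≤-trans (≤r r≡) r≤e))
  , ≤-trans (+-monoˡ-≤ k (m+n≤o⇒m≤o e (s≤s⁻¹ (s≤s⁻¹ (≤-trans (≤-reflexive (sym (+-suc (suc e) (i ∸ k)))) hi)))))
      (≤-reflexive (swap-last b i k))
  where
  ≤r : r ≡ suc b ⊎ r ≡ 2 + b → suc b ≤ r
  ≤r (inj₁ refl) = ≤-refl
  ≤r (inj₂ refl) = n≤1+n _
  swap-last : ∀ b i k → b + suc i + k ≡ suc (b + k) + i
  swap-last = solve-∀

module Start (r m : ℕ) (w : List ℕ) (#w : length w ≡ suc m) (perm : IsPerm (suc m) w)
             (r≤m : r ≤ suc m) where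
  private
    n k b A : ℕ
    n = suc m
    k = m / 2
    b = n / 2
    A = suc n / 2

    A≡1+k : A ≡ suc k
    A≡1+k = half-suc-suc m

    n≡1+b+k : n ≡ suc (b + k)
    n≡1+b+k = trans (sym (halves n)) (trans (cong (λ a → b + a) A≡1+k) (+-suc b k))

  open Coordinates n
  open Dynamics n (suc b)

  -- The inserted label is `suc r`, so `r ≤ n` covers all labels `1, …, n + 1`. This is
  -- `initial (suc r) w` with `n` for `length w`; `unfolded` bridges the two.
  start₀ : Config
  start₀ = (suc r , + 0) ∷ chipsFrom n (suc r) 0 w

  private
    offset : ∀ j → (- (+ k)) ℤ.+ + j ℤ.+ + A ≡ + suc j
    offset j rewrite A≡1+k = ring (+ k) (+ j)
      where
      ring : ∀ z y → (- z) ℤ.+ y ℤ.+ (+ 1 ℤ.+ z) ≡ + 1 ℤ.+ y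
      ring = ℤ.solve-∀

    chipsFrom-row : ∀ j xs → chips n (chipsFrom n (suc r) j xs) ≡ row (suc r) j xs
    chipsFrom-row j []       = refl
    chipsFrom-row j (x ∷ xs) =
      cong₂ _∷_ (cong (relabel (suc r) x ,_) (cong ∣_∣ (offset j))) (chipsFrom-row (suc j) xs)

    chipsFrom-inL : ∀ j xs → j + length xs ≤ n → ∀ {α p} → (α , p) ∈ chipsFrom n (suc r) j xs → InL n p
    chipsFrom-inL j (x ∷ xs) j≤ (here refl) =
      index⇒InL (offset j) (m≤n⇒m≤1+n (≤-trans (s≤s (m≤m+n j (length xs)))
        (≤-trans (≤-reflexive (sym (+-suc j (length xs)))) j≤)))
    chipsFrom-inL j (x ∷ xs) j≤ (there a∈) =
      chipsFrom-inL (suc j) xs (≤-trans (≤-reflexive (sym (+-suc j (length xs)))) j≤) a∈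

    1+b≤n : suc b ≤ n
    1+b≤n = ≤-trans (s≤s (m≤m+n b k)) (≤-reflexive (sym n≡1+b+k))

    A≤n : A ≤ n
    A≤n = ≤-trans (m≤n+m A b) (≤-reflexive (halves n))

    chips-start : chips n start₀ ≡ (suc r , A) ∷ row (suc r) 0 w
    chips-start = cong ((suc r , A) ∷_) (chipsFrom-row 0 w)

    start-inL : AllInL n start₀
    start-inL (here refl) = index⇒InL refl (m≤n⇒m≤1+n A≤n)
    start-inL (there a∈)  = chipsFrom-inL 0 w (≤-reflexive #w) a∈

    g : ℕ → ℕ
    g x = suc (x ∸ A)

    g-suc : ∀ x → g (suc x) ≡ ⟦ A < suc x ⟧ + g x
    g-suc x = trans (cong suc (∸-suc A x)) (sym (+-suc _ (x ∸ A)))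

    profile : Profile n (suc b) (chips n start₀) g
    profile = record
      { labelled = labelled
      ; inside   = All.map⁺ (All.tabulate λ a∈ → index≤ (start-inL a∈))
      ; bottom   = cong suc (0∸n≡0 A)
      ; top      = cong suc (trans (cong (λ z → suc z ∸ A) (sym (halves n))) (m+n∸n≡m (suc b) A))
      ; balance  = balance
      ; mono     = λ {x} _ → ≤-trans (m≤n+m (g x) ⟦ A < suc x ⟧) (≤-reflexive (sym (g-suc x)))
      ; lip      = λ {x} _ → ≤-trans (≤-reflexive (g-suc x)) (+-monoˡ-≤ (g x) (⟦<⟧≤1 A (suc x)))
      }
      where
      labelled : labels (chips n start₀) ↭ map suc (upTo (suc n))
      labelled = begin
        labels (chips n start₀)                                ≡⟨ cong labels chips-start ⟩
        suc r ∷ labels (row (suc r) 0 w)                      ≡⟨ cong (suc r ∷_) (labels-row (suc r) 0 w) ⟩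
        suc r ∷ map (relabel (suc r)) w                       ↭⟨ prep _ (↭.map⁺ _ perm) ⟩
        suc r ∷ map (relabel (suc r)) (map suc (upTo n))      ≡⟨ cong (suc r ∷_) (map-relabel-suc r (upTo n)) ⟩
        map suc (r ∷ map (relabel r) (upTo n))                ↭⟨ ↭.map⁺ suc (relabel-↭ r≤m) ⟩
        map suc (upTo (suc n))                                ∎
        where open PermutationReasoning

      -- The chips of `w` fill the indices `1, …, n` once each and account for `x`; the extra chip
      -- at the index `A` of the origin accounts for the step of `g`.
      balance : ∀ {x} → x ≤ n → #below (suc x) (positions (chips n start₀)) + g x ≡ x + g (suc x)
      balance {x} x≤n = begin
        #below (suc x) (positions (chips n start₀)) + g x
          ≡⟨ cong (λ c → #below (suc x) (positions c) + g x) chips-start ⟩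
        ⟦ A < suc x ⟧ + #below (suc x) (positions (row (suc r) 0 w)) + g x
          ≡⟨ cong (λ ℓ → ⟦ A < suc x ⟧ + #below (suc x) ℓ + g x)
               (trans (positions-row (suc r) w) (cong (map suc ∘ upTo) #w)) ⟩
        ⟦ A < suc x ⟧ + #below (suc x) (map suc (upTo n)) + g x
          ≡⟨ cong (λ l → ⟦ A < suc x ⟧ + l + g x) (#below-upTo⁺ x≤n) ⟩
        ⟦ A < suc x ⟧ + x + g x
          ≡⟨ cong (_+ g x) (+-comm ⟦ A < suc x ⟧ x) ⟩
        x + ⟦ A < suc x ⟧ + g x
          ≡⟨ +-assoc x _ (g x) ⟩
        x + (⟦ A < suc x ⟧ + g x)
          ≡⟨ cong (λ z → x + z) (g-suc x) ⟨
        x + g (suc x)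
          ∎
        where open ≡-Reasoning

    admissible⇔inserted : Admissible (suc b) g (chips n start₀) ⇔
      (∀ i → i < n → Inserted k b (relabel (suc r) (entry w i)) i)
    admissible⇔inserted = mk⇔ to from
      where
      -- The inserted chip is admissible for every label, as `g A` is `1`; so the only conditions
      -- are those on the entries of `w`.
      at-A : g A ≤ suc r × suc r + g A ≤ 2 + b + A
      at-A rewrite n∸n≡0 A = s≤s z≤n ,
        ≤-trans (≤-reflexive (+-comm (suc r) 1))
                (s≤s (s≤s (≤-trans r≤m (≤-reflexive (sym (halves n))))))
      convert : ∀ v i → (g (suc i) ≤ v × v + g (suc i) ≤ 2 + b + suc i) ≡ Inserted k b v i
      convert v i rewrite A≡1+k = refl
      to : Admissible (suc b) g (chips n start₀) → _
      to adm i i<n with _ ∷ as ← subst (Admissible (suc b) g) chips-start adm =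
        subst id (convert _ i) (All-row⁻ (suc r) 0 w as i (subst (i <_) (sym #w) i<n))
      from : (∀ i → i < n → Inserted k b (relabel (suc r) (entry w i)) i) → _
      from ins = subst (Admissible (suc b) g) (sym chips-start)
        (at-A ∷ All-row⁺ (suc r) 0 w λ i i<n → subst id (sym (convert _ i)) (ins i (subst (i <_) #w i<n)))

  sorts⇔inserted : Sorts start₀ ⇔ (∀ i → i < n → Inserted k b (relabel (suc r) (entry w i)) i)
  sorts⇔inserted = admissible⇔inserted ⇔-∘ sorts⇔admissible 1+b≤n start-inL profile

  private
    unfolded : RToppleable (suc r) w ≡ Sorts start₀
    unfolded = cong (λ n → ∃ λ c → Star (Move n) ((suc r , + 0) ∷ chipsFrom n (suc r) 0 w) c
                                   × Stable c × ReadsIdentity c) #w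

  banded⇒toppleable : Banded n w → RToppleable (suc r) w
  banded⇒toppleable band = subst id (sym unfolded) (Equivalence.from sorts⇔inserted λ i i<n →
    let lower , upper = entry-bounds perm (subst (i <_) (sym #w) i<n) in
    banded⇒inserted n≡1+b+k lower upper (relabel-cases (suc r) (entry w i))
      (proj₁ (band i i<n)) (proj₂ (band i i<n)))

  toppleable⇒banded : suc r ≡ suc b ⊎ suc r ≡ 2 + b → RToppleable (suc r) w → Banded n w
  toppleable⇒banded r≡ top i i<n = inserted⇒banded n≡1+b+k i<n r≡
    (Equivalence.to sorts⇔inserted (subst id unfolded top) i i<n)

-- Excedances

entry-map : ∀ (h : ℕ → ℕ) {xs i} → i < length xs → entry (map h xs) i ≡ h (entry xs i)
entry-map h {x ∷ xs} {zero}  _         = refl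
entry-map h {x ∷ xs} {suc i} (s≤s i<n) = entry-map h {xs} i<n

entry-++ˡ : ∀ {xs ys i} → i < length xs → entry (xs ++ ys) i ≡ entry xs i
entry-++ˡ {x ∷ xs} {i = zero}  _         = refl
entry-++ˡ {x ∷ xs} {i = suc i} (s≤s i<n) = entry-++ˡ {xs} i<n

entry-++ʳ : ∀ xs {ys i} → entry (xs ++ ys) (length xs + i) ≡ entry ys i
entry-++ʳ []       = refl
entry-++ʳ (x ∷ xs) = entry-++ʳ xs

entry-reverse : ∀ xs {i j} → suc (i + j) ≡ length xs → entry (reverse xs) i ≡ entry xs j
entry-reverse (x ∷ xs) {i} {j} eq rewrite unfold-reverse x xs with j
... | zero  = trans (cong (entry (reverse xs ∷ʳ x)) i≡) (entry-++ʳ (reverse xs))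
  where
  i≡ : i ≡ length (reverse xs) + 0
  i≡ = trans (sym (+-identityʳ i)) (trans (suc-injective eq)
         (trans (sym (length-reverse xs)) (sym (+-identityʳ _))))
... | suc j = trans
  (entry-++ˡ {reverse xs} (≤-trans (s≤s (m≤m+n i j)) (≤-reflexive (trans eq′ (sym (length-reverse xs))))))
  (entry-reverse xs eq′)
  where
  eq′ : suc (i + j) ≡ length xs
  eq′ = trans (sym (+-suc i j)) (suc-injective eq)

take-length-++ : ∀ (xs ys : List ℕ) → take (length xs) (xs ++ ys) ≡ xs
take-length-++ []       ys = refl
take-length-++ (x ∷ xs) ys = cong (x ∷_) (take-length-++ xs ys)

drop-length-++ : ∀ (xs ys : List ℕ) → drop (length xs) (xs ++ ys) ≡ ys
drop-length-++ []       ys = refl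
drop-length-++ (x ∷ xs) ys = drop-length-++ xs ys

-- The reverse complement, rotated so that the entries at which it is bounded below by the
-- band come first.
flip : ℕ → ℕ → List ℕ → List ℕ
flip n k w = map (suc n ∸_) (reverse (take k w) ++ reverse (drop k w))

flip-++ : ∀ n {k} xs ys → length xs ≡ k →
  flip n k (xs ++ ys) ≡ map (suc n ∸_) (reverse xs ++ reverse ys)
flip-++ n xs ys refl = cong₂ (λ u v → map (suc n ∸_) (reverse u ++ reverse v))
  (take-length-++ xs ys) (drop-length-++ xs ys)

complement-↭ : ∀ n → map (suc n ∸_) (map suc (upTo n)) ↭ map suc (upTo n)
complement-↭ n = begin
  map (suc n ∸_) (map suc (upTo n)) ≡⟨ map-∘ (upTo n) ⟨
  map (n ∸_) (upTo n)               ≡⟨ descending n ⟩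
  map suc (downFrom n)              ≡⟨ cong (map suc) (reverse-upTo n) ⟨
  map suc (reverse (upTo n))        ↭⟨ ↭.map⁺ suc (↭.↭-reverse (upTo n)) ⟩
  map suc (upTo n)                  ∎
  where
  open PermutationReasoning
  descending : ∀ n → map (n ∸_) (upTo n) ≡ map suc (downFrom n)
  descending zero    = refl
  descending (suc n) = trans (cong (map (suc n ∸_)) (upTo-suc n))
    (cong (suc n ∷_) (trans (sym (map-∘ (upTo n))) (descending n)))

flip-perm : ∀ {n} k {w} → IsPerm n w → IsPerm n (flip n k w)
flip-perm {n} k {w} perm = ↭-trans (↭.map⁺ (suc n ∸_) (↭-trans
  (↭.++⁺ (↭.↭-reverse (take k w)) (↭.↭-reverse (drop k w)))
  (↭-trans (↭-reflexive (take++drop≡id k w)) perm))) (complement-↭ n)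

perm-length : ∀ {n w} → IsPerm n w → length w ≡ n
perm-length {n} perm = trans (↭.↭-length perm) (trans (length-map suc (upTo n)) (length-upTo n))

perm-All≤ : ∀ {n w} → IsPerm n w → All (_≤ n) w
perm-All≤ perm = ↭.All-resp-↭ (↭-sym perm) (All.map⁺ (All.tabulate ∈-upTo⁻))

module _ {n k w} (k≤n : k ≤ n) (perm : IsPerm n w) where
  private
    U V : List ℕ
    U = take k w
    V = drop k w

    #U : length U ≡ k
    #U = trans (length-take k w) (trans (cong (k ⊓_) (perm-length perm)) (m≤n⇒m⊓n≡m k≤n))

    #V : length V ≡ n ∸ k
    #V = trans (length-drop k w) (cong (_∸ k) (perm-length perm))

    comp : ℕ → ℕ
    comp = suc n ∸_

    entry-U : ∀ {j} → j < k → entry w j ≡ entry U j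
    entry-U j<k = trans (cong (λ z → entry z _) (sym (take++drop≡id k w)))
                        (entry-++ˡ {U} (subst (_ <_) (sym #U) j<k))

    entry-V : ∀ j → entry w (k + j) ≡ entry V j
    entry-V j = trans (cong₂ entry (sym (take++drop≡id k w)) (cong (_+ j) (sym #U))) (entry-++ʳ U)

  -- The first block keeps its length `k`, so the second `flip` cuts at the same place and undoes
  -- both reversals; complementing twice is the identity on entries up to `n`.
  flip-involutive : flip n k (flip n k w) ≡ w
  flip-involutive = begin
    flip n k (map comp (reverse U ++ reverse V))
      ≡⟨ cong (flip n k) (map-++ comp (reverse U) (reverse V)) ⟩
    flip n k (map comp (reverse U) ++ map comp (reverse V))
      ≡⟨ flip-++ n (map comp (reverse U)) (map comp (reverse V))
           (trans (length-map comp (reverse U)) (trans (length-reverse U) #U)) ⟩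
    map comp (reverse (map comp (reverse U)) ++ reverse (map comp (reverse V)))
      ≡⟨ cong (map comp) (cong₂ _++_ (unreverse U) (unreverse V)) ⟩
    map comp (map comp U ++ map comp V)
      ≡⟨ cong (map comp) (map-++ comp U V) ⟨
    map comp (map comp (U ++ V))
      ≡⟨ cong (map comp ∘ map comp) (take++drop≡id k w) ⟩
    map comp (map comp w)
      ≡⟨ map-∘ w ⟨
    map (comp ∘ comp) w
      ≡⟨ map-id-local (All.map (m∸[m∸n]≡n ∘ m≤n⇒m≤1+n) (perm-All≤ perm)) ⟩
    w ∎
    where
    open ≡-Reasoning
    unreverse : ∀ ℓ → reverse (map comp (reverse ℓ)) ≡ map comp ℓ
    unreverse ℓ = trans (cong reverse (reverse-map comp ℓ)) (reverse-involutive (map comp ℓ))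

  entry-flip-left : ∀ {i j} → suc (i + j) ≡ k → entry (flip n k w) i ≡ suc n ∸ entry w j
  entry-flip-left {i} {j} eq = begin
    entry (map comp (reverse U ++ reverse V)) i ≡⟨ entry-map comp {reverse U ++ reverse V} i<n ⟩
    comp (entry (reverse U ++ reverse V) i)     ≡⟨ cong comp (entry-++ˡ {reverse U} i<k) ⟩
    comp (entry (reverse U) i)                  ≡⟨ cong comp (entry-reverse U (trans eq (sym #U))) ⟩
    comp (entry U j)                            ≡⟨ cong comp (entry-U j<k) ⟨
    comp (entry w j)                            ∎
    where
    open ≡-Reasoning
    j<k : j < k
    j<k = ≤-trans (s≤s (m≤n+m j i)) (≤-reflexive eq)
    i<k : i < length (reverse U)
    i<k = ≤-trans (s≤s (m≤m+n i j)) (≤-reflexive (trans eq (sym (trans (length-reverse U) #U))))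
    i<n : i < length (reverse U ++ reverse V)
    i<n = ≤-trans i<k (≤-trans (m≤m+n _ _) (≤-reflexive (sym (length-++ (reverse U)))))

  entry-flip-right : ∀ {t u} → n ≡ k + suc (t + u) → entry (flip n k w) (k + t) ≡ suc n ∸ entry w (k + u)
  entry-flip-right {t} {u} eq = begin
    entry (map comp (reverse U ++ reverse V)) (k + t)
      ≡⟨ cong₂ entry (map-++ comp (reverse U) (reverse V)) (cong (_+ t) (sym #U′)) ⟩
    entry (map comp (reverse U) ++ map comp (reverse V)) (length (map comp (reverse U)) + t)
      ≡⟨ entry-++ʳ (map comp (reverse U)) ⟩
    entry (map comp (reverse V)) t
      ≡⟨ entry-map comp {reverse V} t<n-k ⟩
    comp (entry (reverse V) t)
      ≡⟨ cong comp (entry-reverse V #V′) ⟩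
    comp (entry V u)
      ≡⟨ cong comp (entry-V u) ⟨
    comp (entry w (k + u))
      ∎
    where
    open ≡-Reasoning
    #U′ : length (map comp (reverse U)) ≡ k
    #U′ = trans (length-map comp (reverse U)) (trans (length-reverse U) #U)
    #V′ : suc (t + u) ≡ length V
    #V′ = trans (sym (m+n∸m≡n k (suc (t + u)))) (trans (cong (_∸ k) (sym eq)) (sym #V))
    t<n-k : t < length (reverse V)
    t<n-k = ≤-trans (s≤s (m≤m+n t u)) (≤-reflexive (trans #V′ (sym (length-reverse V))))

split-left : ∀ {i k} → i < k → ∃ λ j → suc (i + j) ≡ k
split-left {i} {k} i<k = k ∸ suc i , m+[n∸m]≡n i<k

split-right : ∀ {i k n} → k ≤ i → i < n → ∃ λ t → ∃ λ u → i ≡ k + t × n ≡ k + suc (t + u)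
split-right {i} {k} {n} k≤i i<n = i ∸ k , n ∸ suc i , sym (m+[n∸m]≡n k≤i) , (begin
  n                                   ≡⟨ m+[n∸m]≡n i<n ⟨
  suc i + (n ∸ suc i)                 ≡⟨ cong (λ z → suc z + (n ∸ suc i)) (m+[n∸m]≡n k≤i) ⟨
  suc (k + (i ∸ k)) + (n ∸ suc i)     ≡⟨ cong suc (+-assoc k (i ∸ k) (n ∸ suc i)) ⟩
  suc (k + (i ∸ k + (n ∸ suc i)))     ≡⟨ +-suc k _ ⟨
  k + suc (i ∸ k + (n ∸ suc i))       ∎)
  where open ≡-Reasoning

-- Reversing the first block pairs `i` with `j = k − 1 − i`, and the upper bound of the band becomes
-- `e ≤ n − 1 − i`: an excedance of the complement at the 1-based place `suc i`.
complement-> : ∀ {n k e i j} → suc (i + j) ≡ k → e ≤ n → suc i < suc n ∸ e ⇔ e + k ≤ n + j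
complement-> {n} {e = e} {i} {j} refl e≤n = mk⇔
  (λ exc → ≤-trans (≤-reflexive (ring₁ e i j))
     (+-monoˡ-≤ j (s≤s⁻¹ (m≤o∸n⇒m+n≤o (2 + i) (m≤n⇒m≤1+n e≤n) exc))))
  (λ le → m+n≤o⇒m≤o∸n (2 + i) (s≤s (+-cancelʳ-≤ j _ n (≤-trans (≤-reflexive (sym (ring₁ e i j))) le))))
  where
  ring₁ : ∀ e i j → e + suc (i + j) ≡ suc (i + e) + j
  ring₁ = solve-∀

-- Both sides say `suc u ≤ e`; the left one is a non-excedance at the 1-based place `suc (k + t)`.
complement-≤ : ∀ {n k e t u} → n ≡ k + suc (t + u) →
  suc n ∸ e ≤ suc (k + t) ⇔ suc (k + u) ≤ e + k
complement-≤ {k = k} {e} {t} {u} refl = mk⇔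
  (λ le → +-cancelʳ-≤ (suc t) _ _ (≤-trans (≤-reflexive (sym (ring₁ k t u)))
     (≤-trans (m∸n≤o⇒m≤n+o _ e le) (≤-reflexive (ring₂ e k t)))))
  (λ lt → m≤n+o⇒m∸n≤o _ e (≤-trans (≤-reflexive (ring₁ k t u))
     (≤-trans (+-monoˡ-≤ (suc t) lt) (≤-reflexive (sym (ring₂ e k t))))))
  where
  ring₁ : ∀ k t u → suc (k + suc (t + u)) ≡ suc (k + u) + suc t
  ring₁ = solve-∀
  ring₂ : ∀ e k t → e + suc (k + t) ≡ e + k + suc t
  ring₂ = solve-∀
  m∸n≤o⇒m≤n+o : ∀ m n {o} → m ∸ n ≤ o → m ≤ n + o
  m∸n≤o⇒m≤n+o m n le = ≤-trans (m≤n+m∸n m n) (+-monoʳ-≤ n le)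

-- At places `j < k` the lower bound of the band is automatic, since `suc j ≤ k`; at `j ≥ k` the
-- upper one is, since the entry is at most `n`. After `flip` the remaining bounds say that exactly
-- the places `1, …, k` are excedances.
banded⇔excedances : ∀ {n w} → IsPerm n w →
  Banded n w ⇔ ExcSetIsInitial ((n ∸ 1) / 2) (flip n ((n ∸ 1) / 2) w)
banded⇔excedances {n} {w} perm = mk⇔ (λ band i → mk⇔ (⇒small band i) (small⇒ band i)) exc⇒
  where
  k = (n ∸ 1) / 2
  σ = flip n k w

  k≤n : k ≤ n
  k≤n = ≤-trans (m/n≤m (n ∸ 1) 2) (m∸n≤m n 1)

  #σ : length σ ≡ n
  #σ = perm-length (flip-perm k perm)

  e≤n : ∀ {j} → j < n → entry w j ≤ n
  e≤n j<n = proj₂ (entry-bounds perm (subst (_ <_) (sym (perm-length perm)) j<n))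

  left : ∀ {i j} → suc (i + j) ≡ k → suc i < entry σ i ⇔ entry w j + k ≤ n + j
  left {i} {j} eq = subst (λ z → suc i < z ⇔ entry w j + k ≤ n + j)
    (sym (entry-flip-left k≤n perm eq))
    (complement-> eq (e≤n (≤-trans (s≤s (m≤n+m j i)) (≤-trans (≤-reflexive eq) k≤n))))

  right : ∀ {t u} → n ≡ k + suc (t + u) →
          entry σ (k + t) ≤ suc (k + t) ⇔ suc (k + u) ≤ entry w (k + u) + k
  right {t} {u} eq = subst (λ z → z ≤ suc (k + t) ⇔ suc (k + u) ≤ entry w (k + u) + k)
    (sym (entry-flip-right k≤n perm eq)) (complement-≤ {e = entry w (k + u)} eq)

  ⇒small : Banded n w → ∀ i → IsExcedance σ i → 1 ≤ i × i ≤ k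
  ⇒small band (suc i) ((1≤i , i<n) , exc) with suc i ≤? k
  ... | yes i<k = 1≤i , i<k
  ... | no  i≮k with t , u , refl , n≡ ← split-right (s≤s⁻¹ (≰⇒> i≮k)) (subst (i <_) #σ i<n) =
    contradiction exc (≤⇒≯ (Equivalence.from (right n≡) (proj₁ (band (k + u) k+u<n))))
    where
    k+u<n : k + u < n
    k+u<n = ≤-trans (≤-reflexive (sym (+-suc k u)))
      (≤-trans (+-monoʳ-≤ k (s≤s (m≤n+m u t))) (≤-reflexive (sym n≡)))

  small⇒ : Banded n w → ∀ i → 1 ≤ i × i ≤ k → IsExcedance σ i
  small⇒ band (suc i) (1≤i , i<k) with j , k≡ ← split-left i<k =
      (1≤i , ≤-trans i<k (≤-trans k≤n (≤-reflexive (sym #σ))))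
    , Equivalence.from (left k≡) (proj₂ (band j (≤-trans (s≤s (m≤n+m j i)) (≤-trans (≤-reflexive k≡) k≤n))))

  exc⇒ : ExcSetIsInitial k σ → Banded n w
  exc⇒ exc j j<n with j <? k
  ... | yes j<k with i , k≡ ← split-left j<k =
      ≤-trans j<k (m≤n+m k (entry w j))
    , Equivalence.to (left k≡′) (proj₂ (Equivalence.from (exc (suc i))
        (s≤s z≤n , ≤-trans (s≤s (m≤n+m i j)) (≤-reflexive k≡))))
    where
    k≡′ : suc (i + j) ≡ k
    k≡′ = trans (cong suc (+-comm i j)) k≡
  ... | no  j≮k with u , t , refl , n≡ ← split-right (≮⇒≥ j≮k) j<n =
      Equivalence.to (right n≡′) (≮⇒≥ not-exc)
    , +-mono-≤ (e≤n j<n) (m≤m+n k u)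
    where
    n≡′ : n ≡ k + suc (t + u)
    n≡′ = trans n≡ (cong (λ z → k + suc z) (+-comm u t))
    i<n : k + t < n
    i<n = ≤-trans (≤-reflexive (sym (+-suc k t)))
      (≤-trans (+-monoʳ-≤ k (s≤s (m≤m+n t u))) (≤-reflexive (sym n≡′)))
    not-exc : ¬ (suc (k + t) < entry σ (k + t))
    not-exc lt = contradiction
      (proj₂ (Equivalence.to (exc (suc (k + t))) ((s≤s z≤n , subst (k + t <_) (sym #σ) i<n) , lt)))
      (<⇒≱ (s≤s (m≤m+n k t)))

-- Enumeration

_↭?_ : (xs ys : List ℕ) → Dec (xs ↭ ys)
[]       ↭? []       = yes ↭-refl
[]       ↭? (y ∷ ys) = no (↭.¬x∷xs↭[] ∘ ↭-sym)
(x ∷ xs) ↭? ys with x ∈? ys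
... | no  x∉ = no λ p → x∉ (↭.∈-resp-↭ p (here refl))
... | yes x∈ with as , bs , refl ← ∈-∃++ x∈ =
  map′ (λ p → ↭-trans (prep x p) (↭-sym (↭.shift x as bs)))
       (λ p → ↭.drop-∷ (↭-trans p (↭.shift x as bs)))
       (xs ↭? (as ++ bs))

words : List ℕ → ℕ → List (List ℕ)
words alphabet zero    = [] ∷ []
words alphabet (suc n) = cartesianProductWith _∷_ alphabet (words alphabet n)

words-unique : ∀ {alphabet} → Unique alphabet → ∀ n → Unique (words alphabet n)
words-unique a! zero    = [] ∷ []
words-unique a! (suc n) = Unique.cartesianProductWith⁺ _∷_ ∷-injective a! (words-unique a! n)

∈-words : ∀ {alphabet w} → All (_∈ alphabet) w → w ∈ words alphabet (length w)
∈-words []        = here refl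
∈-words (x∈ ∷ w∈) = ∈-cartesianProductWith⁺ _∷_ x∈ (∈-words w∈)

perms : ℕ → List (List ℕ)
perms n = filter (_↭? map suc (upTo n)) (words (map suc (upTo n)) n)

perms-unique : ∀ n → Unique (perms n)
perms-unique n = Unique.filter⁺ (_↭? map suc (upTo n))
  (words-unique (Unique.map⁺ suc-injective (Unique.upTo⁺ n)) n)

∈-perms⁻ : ∀ {n w} → w ∈ perms n → IsPerm n w
∈-perms⁻ {n} w∈ = proj₂ (∈-filter⁻ (_↭? map suc (upTo n)) {xs = words (map suc (upTo n)) n} w∈)

∈-perms⁺ : ∀ {n w} → IsPerm n w → w ∈ perms n
∈-perms⁺ {n} {w} perm = ∈-filter⁺ (_↭? map suc (upTo n))
  (subst (λ m → w ∈ words (map suc (upTo n)) m) (perm-length perm)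
    (∈-words (All.tabulate (↭.∈-resp-↭ perm)))) perm

banded? : ∀ n w → Dec (Banded n w)
banded? n w = map′ (λ h i → h {i}) (λ h {i} → h i)
  (allUpTo? (λ i → (suc i ≤? entry w i + k) ×-dec (entry w i + k ≤? n + i)) n)
  where k = (n ∸ 1) / 2

bandedPerms : ℕ → List (List ℕ)
bandedPerms n = filter (banded? n) (perms n)

bandedPerms-unique : ∀ n → Unique (bandedPerms n)
bandedPerms-unique n = Unique.filter⁺ (banded? n) (perms-unique n)

∈-bandedPerms : ∀ n w → w ∈ bandedPerms n ⇔ (IsPerm n w × Banded n w)
∈-bandedPerms n w = mk⇔
  (λ w∈ → let w∈perms , band = ∈-filter⁻ (banded? n) {xs = perms n} w∈ in ∈-perms⁻ w∈perms , band)
  (λ (perm , band) → ∈-filter⁺ (banded? n) (∈-perms⁺ perm) band)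

-- One list witnesses every count whose property is equivalent to the band, so equality of these
-- numbers needs no bijection.
count-banded : ∀ {n} {P : List ℕ → Set} → (∀ {w} → IsPerm n w → Banded n w ⇔ P w) →
  Count (λ w → IsPerm n w × P w) (length (bandedPerms n))
count-banded {n} {P} equiv = bandedPerms n , bandedPerms-unique n , refl , λ w → mk⇔
  (λ w∈ → let perm , band = Equivalence.to (∈-bandedPerms n w) w∈ in
          perm , Equivalence.to (equiv perm) band)
  (λ (perm , p) → Equivalence.from (∈-bandedPerms n w) (perm , Equivalence.from (equiv perm) p))

count-excedances : ∀ n →
  Count (λ w → IsPerm n w × ExcSetIsInitial ((n ∸ 1) / 2) w) (length (bandedPerms n))
count-excedances n = map f (bandedPerms n) , unique , length-map f (bandedPerms n) , λ w → mk⇔ to from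
  where
  k = (n ∸ 1) / 2
  f = flip n k

  k≤n : k ≤ n
  k≤n = ≤-trans (m/n≤m (n ∸ 1) 2) (m∸n≤m n 1)

  unique : Unique (map f (bandedPerms n))
  -- Applying `f` once more returns `bandedPerms n`, and a list whose image has no duplicates has
  -- none itself.
  unique = Unique.map⁻ {f = f} (subst Unique (sym (trans (sym (map-∘ (bandedPerms n)))
    (map-id-local (All.tabulate λ w∈ →
      flip-involutive k≤n (proj₁ (Equivalence.to (∈-bandedPerms n _) w∈)))))) (bandedPerms-unique n))

  to : ∀ {w} → w ∈ map f (bandedPerms n) → IsPerm n w × ExcSetIsInitial k w
  to w∈ with v , v∈ , refl ← ∈-map⁻ f w∈ =
    let perm , band = Equivalence.to (∈-bandedPerms n v) v∈ in
    flip-perm k perm , Equivalence.to (banded⇔excedances perm) band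

  from : ∀ {w} → IsPerm n w × ExcSetIsInitial k w → w ∈ map f (bandedPerms n)
  from {w} (perm , exc) = subst (_∈ map f (bandedPerms n)) (flip-involutive k≤n perm)
    (∈-map⁺ f (Equivalence.from (∈-bandedPerms n (f w)) (flip-perm k perm ,
      Equivalence.from (banded⇔excedances (flip-perm k perm))
        (subst (ExcSetIsInitial k) (sym (flip-involutive k≤n perm)) exc))))

-- Toppleability as the band condition

banded⇔toppleable-at : ∀ {n r w} → 2 ≤ n → IsPerm n w → r ≡ n / 2 ⊎ r ≡ suc (n / 2) →
  Banded n w ⇔ RToppleable (suc r) w
banded⇔toppleable-at {suc m} {r} {w} 2≤n perm r≡ =
  mk⇔ banded⇒toppleable (toppleable⇒banded (Sum.map (cong suc) (cong suc) r≡))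
  where
  n/2<n : suc m / 2 < suc m
  n/2<n = m/n<m (suc m) 2 ≤-refl
  bound : r ≡ suc m / 2 ⊎ r ≡ suc (suc m / 2) → r ≤ suc m
  bound (inj₁ refl) = <⇒≤ n/2<n
  bound (inj₂ refl) = n/2<n
  open Start r m w (perm-length perm) perm (bound r≡)

-- The band gives toppleability for all inserted labels at once, and the single label `suc (n / 2)`
-- already gives the band back.
banded⇔toppleable : ∀ {n w} → 2 ≤ n → IsPerm n w → Banded n w ⇔ Toppleable w
banded⇔toppleable {suc m} {w} 2≤n perm = mk⇔ to from
  where
  to : Banded (suc m) w → Toppleable w
  to band (suc r) _ r≤ = Start.banded⇒toppleable r m w (perm-length perm) perm
    (subst (r ≤_) (perm-length perm) (s≤s⁻¹ r≤)) band
  from : Toppleable w → Banded (suc m) w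
  from top = Equivalence.from (banded⇔toppleable-at 2≤n perm (inj₁ refl))
    (top (suc (suc m / 2)) (s≤s z≤n) (s≤s (subst (suc m / 2 ≤_) (sym (perm-length perm)) (m/n≤m (suc m) 2))))

theorem2p4 : ∀ (n : ℕ) → 2 ≤ n → ∃ λ k →
    Count (λ w → IsPerm n w × Toppleable w) k
    × Count (λ w → IsPerm n w × RToppleable (suc (n / 2)) w) k
    × Count (λ w → IsPerm n w × RToppleable (suc (suc (n / 2))) w) k
    × Count (λ w → IsPerm n w × ExcSetIsInitial ((n ∸ 1) / 2) w) k
theorem2p4 n 2≤n = length (bandedPerms n)
  , count-banded (banded⇔toppleable 2≤n)
  , count-banded (λ perm → banded⇔toppleable-at 2≤n perm (inj₁ refl))
  , count-banded (λ perm → banded⇔toppleable-at 2≤n perm (inj₂ refl))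
  , count-excedances n
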